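{- Let $N\ge2$, $T\ge1$, loads $L_1,\dots,L_T\in\mathbb{R}_{\ge0}^N$ and SLAs $\beta(i)\ge0$ with $\sum_i\beta(i)\le1$ be given. For any $0<\varepsilon\le\frac1{10}$ and $0<\eta<\frac13$, Algorithm 1 (defined in the context) run with parameters $\varepsilon,\eta$ guarantees $$\mathrm{work}_{h_1^*,\dots,h_t^*}-\mathrm{work}_{\mathrm{alg},t}\ \le\ 8\,\frac{N}{\varepsilon^2\eta}\,\ln(N/\varepsilon)$$ for any time $1\le t\le T$, where $h_1^*,\dots,h_T^*$ is the optimal offline sequence of $(1-4\varepsilon)$-allocations (maximizing total work over the horizon $T$ among sequences of $(1-4\varepsilon)$-allocations, loads known in advance) and $\mathrm{work}_{\mathrm{alg},t}=\sum_i\sum_{\tau=1}^t w_\tau(i)$ is the work done by Algorithm 1 until time $t$.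
   Context: Model. There are $N\ge 2$ users sharing one resource of capacity $1$ over discrete times $t=1,\dots,T$. User $i$ has an SLA $\beta(i)\ge 0$. At time $t$ a load $L_t(i)\ge 0$ arrives for user $i$. Given allocations $h_1,\dots,h_T\in[0,1]^N$ with $\sum_i h_t(i)\le 1$, the work and the queues are defined by $Q_1(i)=0$ and $$w_t(i)=\min\{h_t(i),\,L_t(i)+Q_t(i)\},\qquad Q_{t+1}(i)=\max\{0,\,L_t(i)+Q_t(i)-h_t(i)\}.$$ The work of the allocations up to time $t$ is $\mathrm{work}_{h_1,\dots,h_t}=\sum_{s=1}^t\sum_{i=1}^N w_s(i)$. For $0<\delta<1$, a $(1-\delta)$-allocation is a vector $h\in[0,1]^N$ with $\sum_i h(i)\le1-\delta$. At time $t$ the only feedback is the set of active users $A_t=\{i: Q_t(i)>0\}$ and inactive users $B_t=\{1,\dots,N\}\setminus A_t$. Truncated simplex and projection. $\Delta_\varepsilon=\{x\in\mathbb{R}^N:\sum_i x(i)=1,\ x(i)\ge\varepsilon/N\ \forall i\}$, and for $y$ with positive entries $\pi_{\Delta_\varepsilon}(y)=\operatorname{argmin}_{x\in\Delta_\varepsilon}\sum_i x(i)\log(x(i)/y(i))$. Algorithm 1 (parameters $\varepsilon,\eta$). Set $\lambda=\frac{\varepsilon^2}{8N}$ and let $h_1$ be any element of $\Delta_\varepsilon$. For $t=1,\dots,T$: use allocation $h_t$; read $A_t,B_t$; let $A_t^1=\{i\in A_t:h_t(i)<\beta(i)\}$ and $A_t^2=A_t\setminus A_t^1$; set $g_t(i)=1+\lambda$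 for $i\in A_t^1$, $g_t(i)=1$ for $i\in A_t^2$, $g_t(i)=0$ for $i\in B_t$; set $\widehat h_{t+1}(i)=h_t(i)e^{\eta g_t(i)}$ and $h_{t+1}=\pi_{\Delta_\varepsilon}(\widehat h_{t+1})$. -}

module Defs where

open import Level using (suc; _⊔_)
open import Algebra.Apartness.Bundles using (HeytingField; HeytingCommutativeRing)
open import Algebra.Apartness.Structures using (IsHeytingField)
import Algebra.Apartness.Properties.HeytingCommutativeRing as HeytingProperties
open import Algebra.Bundles using (CommutativeRing)
import Algebra.Definitions.RawMonoid as RawMonoidDefinitions
import Algebra.Properties.Ring as RingProperties
open import Data.Bool.Base using (if_then_else_)
open import Data.Fin.Subset using (Subset; _∈_)
open import Data.Fin.Subset.Properties using (_∈?_)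
open import Data.Nat.Base as ℕ using (ℕ)
open import Data.Nat.Properties using (≤-trans; n≤1+n)
open import Data.Product.Base using (Σ-syntax; ∃-syntax; _×_; _,_; proj₁; proj₂)
open import Data.Sum.Base using (_⊎_; inj₁; inj₂)
open import Data.Vec.Functional using (Vector)
open import Function.Bundles using (_⇔_)
open import Relation.Binary.Core using (Rel)
open import Relation.Binary.Lattice.Structures using (IsLattice)
open import Relation.Binary.Structures using (IsStrictPartialOrder)
open import Relation.Nullary.Decidable.Core using (does)
open import Relation.Nullary.Negation using (¬_; contradiction)

-- The real numbers as the Cauchy-complete Archimedean ordered field, together
-- with exp and ln.  The axioms are the constructive ones: they hold for the
-- Cauchy reals (so the order is not assumed decidable, `x ≤ y` is `¬ y < x`,
-- and inverses and logarithms take a proof of positivity), and with excluded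
-- middle they determine ℝ up to isomorphism.

record Reals c ℓ₁ ℓ₂ : Set (suc (c ⊔ ℓ₁ ⊔ ℓ₂)) where
  infix  8 -_
  infixl 7 _*_
  infixl 6 _+_ _⊔ᵣ_ _⊓ᵣ_
  infix  4 _≈_ _<_ _≤_ _#_

  field
    Carrier  : Set c
    _≈_      : Rel Carrier ℓ₁
    _<_      : Rel Carrier ℓ₂
    _+_ _*_  : Carrier → Carrier → Carrier
    -_       : Carrier → Carrier
    0# 1#    : Carrier
    _⊔ᵣ_     : Carrier → Carrier → Carrier
    _⊓ᵣ_     : Carrier → Carrier → Carrier

  _≤_ : Rel Carrier ℓ₂
  x ≤ y = ¬ (y < x)

  _#_ : Rel Carrier ℓ₂
  x # y = (x < y) ⊎ (y < x)

  field
    isHeytingField       : IsHeytingField _≈_ _#_ _+_ _*_ -_ 0# 1#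
    isStrictPartialOrder : IsStrictPartialOrder _≈_ _<_
    +-monoˡ-<            : ∀ z {x y} → x < y → x + z < y + z
    *-pos                : ∀ {x y} → 0# < x → 0# < y → 0# < x * y
    isLattice            : IsLattice _≈_ _≤_ _⊔ᵣ_ _⊓ᵣ_

  heytingField : HeytingField c ℓ₁ ℓ₂
  heytingField = record { isHeytingField = isHeytingField }

  open HeytingField heytingField public
    using (heytingCommutativeRing; #⇒invertible; invertible⇒#; tight)

  open HeytingCommutativeRing heytingCommutativeRing public
    using (commutativeRing)

  open CommutativeRing commutativeRing public
    using ( ring; setoid; _-_; refl; sym; trans
          ; +-cong; +-congˡ; +-congʳ; +-assoc; +-comm
          ; +-identityˡ; +-identityʳ; -‿cong; -‿inverseˡ; -‿inverseʳ
          ; *-cong; *-congˡ; *-congʳ; *-assoc; *-comm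
          ; *-identityˡ; *-identityʳ; distribˡ; distribʳ; zeroˡ; zeroʳ )

  open IsStrictPartialOrder isStrictPartialOrder public
    using (<-resp-≈; <-respˡ-≈; <-respʳ-≈)
    renaming (irrefl to <-irrefl; trans to <-trans; asym to <-asym)

  open RawMonoidDefinitions (CommutativeRing.+-rawMonoid commutativeRing) public
    using (sum) renaming (_×_ to _·_)

  fromℕ : ℕ → Carrier
  fromℕ n = n · 1#

  ∣_∣ : Carrier → Carrier
  ∣ x ∣ = x ⊔ᵣ (- x)

  Cauchy : (ℕ → Carrier) → Set (c ⊔ ℓ₂)
  Cauchy s = ∀ e → 0# < e → ∃[ m ] ∀ p q → m ℕ.≤ p → m ℕ.≤ q → ∣ s p - s q ∣ < e

  _⟶_ : (ℕ → Carrier) → Carrier → Set (c ⊔ ℓ₂)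
  s ⟶ l = ∀ e → 0# < e → ∃[ m ] ∀ p → m ℕ.≤ p → ∣ s p - l ∣ < e

  field
    archimedean : ∀ x → ∃[ n ] x < fromℕ n
    complete    : ∀ s → Cauchy s → ∃[ l ] s ⟶ l

  R⁺ : Set (c ⊔ ℓ₂)
  R⁺ = Σ[ x ∈ Carrier ] 0# < x

  -- The homomorphism from addition to multiplication is pinned down to base e
  -- by the tangent inequality 1 + x ≤ exp x: it forces
  -- (1 + x / n) ^ n ≤ exp x ≤ (1 - x / n) ^ (- n) for all large n.
  field
    exp      : Carrier → Carrier
    exp-cong : ∀ {x y} → x ≈ y → exp x ≈ exp y
    exp-pos  : ∀ x → 0# < exp x
    exp-+    : ∀ x y → exp (x + y) ≈ exp x * exp y
    1+x≤exp  : ∀ x → 1# + x ≤ exp x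
    ln       : R⁺ → Carrier
    exp-ln   : ∀ x → exp (ln x) ≈ proj₁ x

  private
    open HeytingProperties heytingCommutativeRing using (x-0≈x; 1#0)
    open RingProperties ring using (-‿distribˡ-*; -‿involutive)

  x<0⇒0<-x : ∀ {x} → x < 0# → 0# < - x
  x<0⇒0<-x {x} x<0 =
    <-respʳ-≈ (+-identityˡ (- x)) (<-respˡ-≈ (-‿inverseʳ x) (+-monoˡ-< (- x) x<0))

  0<-x⇒x<0 : ∀ {x} → 0# < - x → x < 0#
  0<-x⇒x<0 {x} 0<-x =
    <-respʳ-≈ (-‿inverseˡ x) (<-respˡ-≈ (+-identityˡ x) (+-monoˡ-< x 0<-x))

  0<1 : 0# < 1#
  0<1 with 1#0
  ... | inj₂ p = p
  ... | inj₁ 1<0 = contradiction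
    (0<-x⇒x<0 (<-respʳ-≈ (trans (*-comm _ _) (*-identityˡ _)) (*-pos (x<0⇒0<-x 1<0) 0<1′)))
    (<-asym 0<1′)
    where
    -1*-1≈1 : (- 1#) * (- 1#) ≈ 1#
    -1*-1≈1 = trans (sym (-‿distribˡ-* 1# (- 1#)))
                (trans (-‿cong (*-identityˡ (- 1#))) (-‿involutive 1#))
    0<1′ : 0# < 1#
    0<1′ = <-respʳ-≈ -1*-1≈1 (*-pos (x<0⇒0<-x 1<0) (x<0⇒0<-x 1<0))

  0<1+n : ∀ n → 0# < fromℕ (ℕ.suc n)
  0<1+n ℕ.zero    = <-respʳ-≈ (sym (+-identityʳ 1#)) 0<1
  0<1+n (ℕ.suc n) = <-trans (0<1+n n)
    (<-respˡ-≈ (+-identityˡ _) (+-monoˡ-< (fromℕ (ℕ.suc n)) 0<1))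

  fromℕ⁺ : ∀ n → .{{ℕ.NonZero n}} → R⁺
  fromℕ⁺ n@(ℕ.suc m) = fromℕ n , 0<1+n m

  infix  8 _⁻¹
  infixl 7 _/_ _*⁺_ _/⁺_

  _⁻¹ : R⁺ → Carrier
  (_ , 0<x) ⁻¹ = proj₁ (#⇒invertible (inj₂ 0<x))

  ⁻¹-inverseʳ : ∀ x → proj₁ x * x ⁻¹ ≈ 1#
  ⁻¹-inverseʳ (x , 0<x) =
    trans (*-congʳ (sym (x-0≈x x))) (proj₂ (proj₂ (#⇒invertible (inj₂ 0<x))))

  ⁻¹-pos : ∀ x → 0# < x ⁻¹
  ⁻¹-pos x with invertible⇒# {x ⁻¹} {0#}
                  ( proj₁ x
                  , trans (*-congˡ (x-0≈x _)) (⁻¹-inverseʳ x)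
                  , trans (*-congʳ (x-0≈x _)) (trans (*-comm _ _) (⁻¹-inverseʳ x)) )
  ... | inj₂ 0<x⁻¹ = 0<x⁻¹
  ... | inj₁ x⁻¹<0 = contradiction (<-trans 0<1 (0<-x⇒x<0 0<-1)) (<-irrefl refl)
    where
    0<-1 : 0# < - 1#
    0<-1 = <-respʳ-≈
      (trans (sym (-‿distribˡ-* (x ⁻¹) (proj₁ x)))
        (-‿cong (trans (*-comm _ _) (⁻¹-inverseʳ x))))
      (*-pos (x<0⇒0<-x x⁻¹<0) (proj₂ x))

  _/_ : Carrier → R⁺ → Carrier
  x / y = x * y ⁻¹

  _*⁺_ : R⁺ → R⁺ → R⁺
  (x , 0<x) *⁺ (y , 0<y) = x * y , *-pos 0<x 0<y

  _/⁺_ : R⁺ → R⁺ → R⁺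
  (x , 0<x) /⁺ y = x / y , *-pos 0<x (⁻¹-pos y)

module SharedResource {c ℓ₁ ℓ₂} (R : Reals c ℓ₁ ℓ₂) (N : ℕ) (2≤N : 2 ℕ.≤ N) where

  open Reals R

  N⁺ : R⁺
  N⁺ = fromℕ⁺ N {{ℕ.>-nonZero (≤-trans (n≤1+n 1) 2≤N)}}

  -- Families indexed by time are functions on ℕ whose relevant values are
  -- those at times 1, 2, …, T.

  Loads : Set c
  Loads = ℕ → Vector Carrier N

  Allocations : Set c
  Allocations = ℕ → Vector Carrier N

  -- The queues start empty at time 1; time 0 is a dummy.
  Q : Loads → Allocations → ℕ → Vector Carrier N
  Q L h 0                     i = 0#
  Q L h 1                     i = 0#
  Q L h (ℕ.suc t@(ℕ.suc _)) i = 0# ⊔ᵣ (L t i + Q L h t i - h t i)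

  w : Loads → Allocations → ℕ → Vector Carrier N
  w L h t i = h t i ⊓ᵣ (L t i + Q L h t i)

  work : Loads → Allocations → ℕ → Carrier
  work L h ℕ.zero    = 0#
  work L h (ℕ.suc t) = work L h t + sum (w L h (ℕ.suc t))

  record IsAllocation (δ : Carrier) (h : Vector Carrier N) : Set ℓ₂ where
    field
      0≤h      : ∀ i → 0# ≤ h i
      h≤1      : ∀ i → h i ≤ 1#
      capacity : sum h ≤ 1# - δ

  AreAllocations : ℕ → Carrier → Allocations → Set ℓ₂
  AreAllocations T δ h = ∀ t → 1 ℕ.≤ t → t ℕ.≤ T → IsAllocation δ (h t)

  record IsOptimalOffline (T : ℕ) (L : Loads) (δ : Carrier) (h* : Allocations)
         : Set (c ⊔ ℓ₂) where
    field
      feasible : AreAllocations T δ h*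
      optimal  : ∀ h → AreAllocations T δ h → work L h T ≤ work L h* T

  record Δ (ε : R⁺) : Set (c ⊔ ℓ₁ ⊔ ℓ₂) where
    field
      coord : Vector Carrier N
      sum≈1 : sum coord ≈ 1#
      lower : ∀ i → proj₁ ε / N⁺ ≤ coord i

    coord-pos : ∀ i → 0# < coord i
    coord-pos i with IsHeytingField.#-cotrans isHeytingField
                       (inj₁ (proj₂ (ε /⁺ N⁺))) (coord i)
    ... | inj₁ (inj₁ 0<x)   = 0<x
    ... | inj₁ (inj₂ x<0)   = contradiction (<-trans x<0 (proj₂ (ε /⁺ N⁺))) (lower i)
    ... | inj₂ (inj₁ x<ε/N) = contradiction x<ε/N (lower i)
    ... | inj₂ (inj₂ ε/N<x) = <-trans (proj₂ (ε /⁺ N⁺)) ε/N<x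

    coord⁺ : Vector R⁺ N
    coord⁺ i = coord i , coord-pos i

  open Δ public using (coord; coord⁺)

  relativeEntropy : Vector R⁺ N → Vector R⁺ N → Carrier
  relativeEntropy x y = sum (λ i → proj₁ (x i) * ln (x i /⁺ y i))

  -- p = π_{Δ_ε}(y), as a minimiser.
  IsProjection : (ε : R⁺) → Vector R⁺ N → Δ ε → Set (c ⊔ ℓ₁ ⊔ ℓ₂)
  IsProjection ε y p =
    ∀ (x : Δ ε) → relativeEntropy (coord⁺ p) y ≤ relativeEntropy (coord⁺ x) y

  λ-of : R⁺ → Carrier
  λ-of ε = proj₁ (ε *⁺ ε /⁺ (fromℕ⁺ 8 *⁺ N⁺))

  gain : R⁺ → (A A¹ : Subset N) → Vector Carrier N
  gain ε A A¹ i =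
    if does (i ∈? A¹) then 1# + λ-of ε
    else if does (i ∈? A) then 1#
    else 0#

  reweight : Carrier → Vector Carrier N → Vector R⁺ N → Vector R⁺ N
  reweight η g h i = h i *⁺ (exp (η * g i) , exp-pos (η * g i))

  -- An execution of the algorithm.  Since the order on the reals need not be
  -- decidable, the outcomes of the comparisons (the sets A and A¹; the
  -- remaining users of A form A²) are part of the execution.
  record Execution (T : ℕ) (L : Loads) (β : Vector Carrier N) (ε : R⁺) (η : Carrier)
         : Set (c ⊔ ℓ₁ ⊔ ℓ₂) where
    field
      h    : ℕ → Δ ε
      A A¹ : ℕ → Subset N

    alloc : Allocations
    alloc t = coord (h t)

    ĥ : ℕ → Vector R⁺ N
    ĥ t = reweight η (gain ε (A t) (A¹ t)) (coord⁺ (h t))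

    field
      active : ∀ t → 1 ℕ.≤ t → t ℕ.≤ T → ∀ i →
               i ∈ A t ⇔ 0# < Q L alloc t i
      below  : ∀ t → 1 ℕ.≤ t → t ℕ.≤ T → ∀ i →
               i ∈ A¹ t ⇔ (i ∈ A t × alloc t i < β i)
      update : ∀ t → 1 ℕ.≤ t → t ℕ.≤ T → IsProjection ε (ĥ t) (h (ℕ.suc t))

module Submission where

open import Algebra.Apartness.Structures using (IsHeytingField)
open import Algebra.Bundles using (CommutativeRing)
import Algebra.Definitions.RawMonoid as RawMonoidDefinitions
import Algebra.Properties.AbelianGroup as AbelianGroupProperties
import Algebra.Properties.Ring as RingProperties
import Algebra.Properties.Semiring.Mult as SemiringMult
import Algebra.Properties.Semiring.Sum as SemiringSum
open import Algebra.Solver.Ring.AlmostCommutativeRing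
  using (_-Raw-AlmostCommutative⟶_; fromCommutativeRing)
open import Data.Fin.Base as Fin using (Fin)
import Data.Fin.Properties as Fin
open import Data.Fin.Subset using (_∈_)
open import Data.Fin.Subset.Properties using (_∈?_)
open import Data.Integer.Base as ℤ using (ℤ; +_; -[1+_]; +-*-rawRing)
open import Data.Integer.Properties using (_≟_; [1+m]⊖[1+n]≡m⊖n)
open import Data.Maybe.Base using (Maybe; just; nothing)
open import Data.Nat.Base as ℕ using (ℕ)
open import Data.Nat.Properties as ℕₚ using (+-suc; m≤n⇒m≤1+n)
open import Data.Product.Base using (∃-syntax; _×_; _,_; proj₁; proj₂)
import Data.Sign.Base as Sign
open import Data.Sum.Base using (inj₁; inj₂)
open import Data.Vec.Functional using (Vector)
open import Function.Base using (_⟨_⟩_)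
open import Function.Bundles using (Equivalence)
open import Relation.Binary.Lattice.Structures using (IsLattice)
import Relation.Binary.Reasoning.Setoid as ≈-Reasoning
open import Relation.Binary.PropositionalEquality as ≡ using (_≡_)
open import Relation.Nullary.Decidable.Core using (Dec; yes; no; ¬¬-excluded-middle)
open import Relation.Nullary.Negation using (¬_; contradiction)
open import Defs

-- Write ηmax = η (1 + λ).  The first-order condition for the projection onto Δ_ε
-- has two consequences.  No allocation shrinks by more than e^(- ηmax) in one
-- step.  And if user i is active, then ∑ⱼ u(j) ln h_t(j), for u the point of
-- Δ_ε closest to the vertex i, grows by a constant times η times the capacity
-- wasted in the previous step, up to an error η (λ + ε).  This potential lies in
-- [- ln (N/ε), 0], so while some user stays active for M ≥ 6 ln (N/ε) / (ε η)
-- steps, the algorithm does at least the work M (1 - 4 ε) that any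
-- (1 - 4 ε)-allocations can do.  A total queue above N M forces such a window,
-- because some user then has a queue above M and loses at most 1 per step;
-- and a total queue of at most N M bounds the work difference directly.

-- Integer coefficients for the ring solver

module IntegerCoefficients {c ℓ} (S : CommutativeRing c ℓ) where

  open CommutativeRing S
  open RawMonoidDefinitions +-rawMonoid using () renaming (_×_ to _·_)
  open SemiringMult semiring using (×-homo-1; ×-homo-+; ×1-homo-*)
  open RingProperties ring using (-‿distribˡ-*; -‿distribʳ-*; -‿involutive; -0#≈0#)
  open AbelianGroupProperties +-abelianGroup using (⁻¹-∙-comm)
  open ≈-Reasoning setoid

  -- Unlike n · 1#, this sends 1 to 1# itself, so that con (+ 1) denotes 1#.
  fromℕ′ : ℕ → Carrier
  fromℕ′ 1 = 1#
  fromℕ′ n = n · 1#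

  fromℕ′≈· : ∀ n → fromℕ′ n ≈ n · 1#
  fromℕ′≈· 0                   = refl
  fromℕ′≈· 1                   = sym (×-homo-1 1#)
  fromℕ′≈· (ℕ.suc (ℕ.suc n)) = refl

  fromℤ : ℤ → Carrier
  fromℤ (+ n)      = fromℕ′ n
  fromℤ (-[1+ n ]) = - fromℕ′ (ℕ.suc n)

  fromℕ′-+ : ∀ m n → fromℕ′ (m ℕ.+ n) ≈ fromℕ′ m + fromℕ′ n
  fromℕ′-+ m n = begin
    fromℕ′ (m ℕ.+ n)      ≈⟨ fromℕ′≈· (m ℕ.+ n) ⟩
    (m ℕ.+ n) · 1#        ≈⟨ ×-homo-+ 1# m n ⟩
    m · 1# + n · 1#       ≈⟨ +-cong (fromℕ′≈· m) (fromℕ′≈· n) ⟨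
    fromℕ′ m + fromℕ′ n ∎

  fromℕ′-* : ∀ m n → fromℕ′ (m ℕ.* n) ≈ fromℕ′ m * fromℕ′ n
  fromℕ′-* m n = begin
    fromℕ′ (m ℕ.* n)      ≈⟨ fromℕ′≈· (m ℕ.* n) ⟩
    (m ℕ.* n) · 1#        ≈⟨ ×1-homo-* m n ⟩
    m · 1# * n · 1#       ≈⟨ *-cong (fromℕ′≈· m) (fromℕ′≈· n) ⟨
    fromℕ′ m * fromℕ′ n ∎

  fromℤ-neg : ∀ i → fromℤ (ℤ.- i) ≈ - fromℤ i
  fromℤ-neg (+ ℕ.zero)   = sym -0#≈0#
  fromℤ-neg (+ ℕ.suc n)  = refl
  fromℤ-neg (-[1+ n ])   = sym (-‿involutive _)

  fromℤ-⊖ : ∀ m n → fromℤ (m ℤ.⊖ n) ≈ fromℕ′ m - fromℕ′ n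
  fromℤ-⊖ m ℕ.zero = begin
    fromℕ′ m       ≈⟨ +-identityʳ _ ⟨
    fromℕ′ m + 0#  ≈⟨ +-congˡ -0#≈0# ⟨
    fromℕ′ m - 0#  ∎
  fromℤ-⊖ ℕ.zero    (ℕ.suc n) = sym (+-identityˡ _)
  fromℤ-⊖ (ℕ.suc m) (ℕ.suc n) = begin
    fromℤ (ℕ.suc m ℤ.⊖ ℕ.suc n)          ≡⟨ ≡.cong fromℤ ([1+m]⊖[1+n]≡m⊖n m n) ⟩
    fromℤ (m ℤ.⊖ n)                       ≈⟨ fromℤ-⊖ m n ⟩
    fromℕ′ m - fromℕ′ n                   ≈⟨ +-congʳ (+-identityˡ _) ⟨
    (0# + fromℕ′ m) - fromℕ′ n            ≈⟨ +-congʳ (+-congʳ (-‿inverseʳ 1#)) ⟨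
    ((1# - 1#) + fromℕ′ m) - fromℕ′ n     ≈⟨ +-congʳ (+-assoc 1# (- 1#) _) ⟩
    (1# + (- 1# + fromℕ′ m)) - fromℕ′ n   ≈⟨ +-congʳ (+-congˡ (+-comm (- 1#) _)) ⟩
    (1# + (fromℕ′ m - 1#)) - fromℕ′ n     ≈⟨ +-congʳ (+-assoc 1# _ _) ⟨
    ((1# + fromℕ′ m) - 1#) - fromℕ′ n     ≈⟨ +-assoc _ (- 1#) _ ⟩
    (1# + fromℕ′ m) + (- 1# - fromℕ′ n)   ≈⟨ +-cong (fromℕ′-+ 1 m) (-‿cong (fromℕ′-+ 1 n) ⟨ trans ⟩ sym (⁻¹-∙-comm 1# _)) ⟨
    fromℕ′ (ℕ.suc m) - fromℕ′ (ℕ.suc n)  ∎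

  fromℤ-+ : ∀ i j → fromℤ (i ℤ.+ j) ≈ fromℤ i + fromℤ j
  fromℤ-+ (+ m)      (+ n)      = fromℕ′-+ m n
  fromℤ-+ (+ m)      (-[1+ n ]) = fromℤ-⊖ m (ℕ.suc n)
  fromℤ-+ (-[1+ m ]) (+ n)      = trans (fromℤ-⊖ n (ℕ.suc m)) (+-comm _ _)
  fromℤ-+ (-[1+ m ]) (-[1+ n ]) = begin
    - fromℕ′ (ℕ.suc (ℕ.suc (m ℕ.+ n)))          ≡⟨ ≡.cong (λ k → - fromℕ′ (ℕ.suc k)) (+-suc m n) ⟨
    - fromℕ′ (ℕ.suc m ℕ.+ ℕ.suc n)              ≈⟨ -‿cong (fromℕ′-+ (ℕ.suc m) (ℕ.suc n)) ⟩
    - (fromℕ′ (ℕ.suc m) + fromℕ′ (ℕ.suc n))     ≈⟨ ⁻¹-∙-comm _ _ ⟨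
    - fromℕ′ (ℕ.suc m) - fromℕ′ (ℕ.suc n)       ∎

  fromℤ-◃- : ∀ n → fromℤ (Sign.- ℤ.◃ n) ≈ - fromℕ′ n
  fromℤ-◃- ℕ.zero    = sym -0#≈0#
  fromℤ-◃- (ℕ.suc n) = refl

  fromℤ-◃+ : ∀ n → fromℤ (Sign.+ ℤ.◃ n) ≈ fromℕ′ n
  fromℤ-◃+ ℕ.zero    = refl
  fromℤ-◃+ (ℕ.suc n) = refl

  fromℤ-* : ∀ i j → fromℤ (i ℤ.* j) ≈ fromℤ i * fromℤ j
  fromℤ-* (+ m)      (+ n)      = trans (fromℤ-◃+ (m ℕ.* n)) (fromℕ′-* m n)
  fromℤ-* (+ m)      (-[1+ n ]) = begin
    fromℤ (Sign.- ℤ.◃ (m ℕ.* ℕ.suc n))  ≈⟨ fromℤ-◃- (m ℕ.* ℕ.suc n) ⟩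
    - fromℕ′ (m ℕ.* ℕ.suc n)            ≈⟨ -‿cong (fromℕ′-* m (ℕ.suc n)) ⟩
    - (fromℕ′ m * fromℕ′ (ℕ.suc n))     ≈⟨ -‿distribʳ-* _ _ ⟩
    fromℕ′ m * - fromℕ′ (ℕ.suc n)       ∎
  fromℤ-* (-[1+ m ]) (+ n)      = begin
    fromℤ (Sign.- ℤ.◃ (ℕ.suc m ℕ.* n))  ≈⟨ fromℤ-◃- (ℕ.suc m ℕ.* n) ⟩
    - fromℕ′ (ℕ.suc m ℕ.* n)            ≈⟨ -‿cong (fromℕ′-* (ℕ.suc m) n) ⟩
    - (fromℕ′ (ℕ.suc m) * fromℕ′ n)     ≈⟨ -‿distribˡ-* _ _ ⟩
    - fromℕ′ (ℕ.suc m) * fromℕ′ n       ∎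
  fromℤ-* (-[1+ m ]) (-[1+ n ]) = begin
    fromℕ′ (ℕ.suc m ℕ.* ℕ.suc n)                ≈⟨ fromℕ′-* (ℕ.suc m) (ℕ.suc n) ⟩
    fromℕ′ (ℕ.suc m) * fromℕ′ (ℕ.suc n)         ≈⟨ -‿involutive _ ⟨
    - - (fromℕ′ (ℕ.suc m) * fromℕ′ (ℕ.suc n))   ≈⟨ -‿cong (-‿distribˡ-* _ _) ⟩
    - (- fromℕ′ (ℕ.suc m) * fromℕ′ (ℕ.suc n))   ≈⟨ -‿distribʳ-* _ _ ⟩
    - fromℕ′ (ℕ.suc m) * - fromℕ′ (ℕ.suc n)     ∎

  fromℤ-morphism : +-*-rawRing -Raw-AlmostCommutative⟶ fromCommutativeRing S
  fromℤ-morphism = record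
    { ⟦_⟧    = fromℤ
    ; +-homo = fromℤ-+
    ; *-homo = fromℤ-*
    ; -‿homo = fromℤ-neg
    ; 0-homo = refl
    ; 1-homo = refl
    }

  -- Equality in `S` need not be decidable; comparing coefficients in `ℤ` is enough for the solver
  -- to cancel terms.
  weaklyDecidable : ∀ i j → Maybe (fromℤ i ≈ fromℤ j)
  weaklyDecidable i j with i ≟ j
  ... | yes ≡.refl = just refl
  ... | no _       = nothing

  open import Algebra.Solver.Ring +-*-rawRing (fromCommutativeRing S) fromℤ-morphism
    weaklyDecidable public
    using (solve; _:=_; _:+_; _:*_; _:-_; :-_; con)

-- Order and arithmetic of the real numbers

module RealProperties {c ℓ₁ ℓ₂} (R : Reals c ℓ₁ ℓ₂) where

  open Reals R
  open IntegerCoefficients commutativeRing public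
    using (solve; _:=_; _:+_; _:*_; _:-_; :-_; con)
  open IsLattice isLattice public
    using (antisym; x≤x∨y; y≤x∨y; ∨-least; x∧y≤x; x∧y≤y; ∧-greatest)
    renaming (reflexive to ≤-reflexive; trans to ≤-trans)
  open SemiringSum (CommutativeRing.semiring commutativeRing) public
    using (sum-cong-≋; ∑-distrib-+; *-distribˡ-sum; sum-replicate)
  open SemiringMult (CommutativeRing.semiring commutativeRing) using (×-assoc-*)

  -- Excluded middle holds only under double negation, so the goal has to be a negation. Every
  -- inequality `≤` is one.
  by-cases : ∀ x y {p} {P : Set p} → (x < y → ¬ P) → (y ≤ x → ¬ P) → ¬ P
  by-cases x y f g p = ¬¬-excluded-middle λ where
    (yes x<y) → f x<y p
    (no  y≤x) → g y≤x p

  ≤-refl : ∀ {x} → x ≤ x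
  ≤-refl = ≤-reflexive refl

  <⇒≤ : ∀ {x y} → x < y → x ≤ y
  <⇒≤ = <-asym

  -- The negation `y ≤ z` yields no strict inequality by itself; cotransitivity of `#`, applied to
  -- `x < y` and `z`, supplies one.
  <-≤-trans : ∀ {x y z} → x < y → y ≤ z → x < z
  <-≤-trans {x} {y} {z} x<y y≤z with IsHeytingField.#-cotrans isHeytingField (inj₁ x<y) z
  ... | inj₁ (inj₁ x<z) = x<z
  ... | inj₁ (inj₂ z<x) = contradiction (<-trans z<x x<y) y≤z
  ... | inj₂ (inj₁ z<y) = contradiction z<y y≤z
  ... | inj₂ (inj₂ y<z) = <-trans x<y y<z

  ≤-respˡ-≈ : ∀ {x y z} → x ≈ y → x ≤ z → y ≤ z
  ≤-respˡ-≈ x≈y x≤z = ≤-trans (≤-reflexive (sym x≈y)) x≤z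

  ≤-respʳ-≈ : ∀ {x y z} → x ≈ y → z ≤ x → z ≤ y
  ≤-respʳ-≈ x≈y z≤x = ≤-trans z≤x (≤-reflexive x≈y)

  <-diff : ∀ {x y} → x < y → 0# < y - x
  <-diff {x} {y} x<y = <-respˡ-≈ (-‿inverseʳ x) (+-monoˡ-< (- x) x<y)

  <-by : ∀ {x y d} → 0# < d → y - x ≈ d → x < y
  <-by {x} {y} 0<d eq = <-respʳ-≈ (solve 2 (λ x y → (y :- x) :+ x := y) refl x y)
    (<-respˡ-≈ (+-identityˡ x) (+-monoˡ-< x (<-respʳ-≈ (sym eq) 0<d)))

  ≤-diff : ∀ {x y} → x ≤ y → 0# ≤ y - x
  ≤-diff {x} {y} x≤y y-x<0 = x≤y (<-respʳ-≈ (+-identityˡ x)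
    (<-respˡ-≈ (solve 2 (λ x y → (y :- x) :+ x := y) refl x y) (+-monoˡ-< x y-x<0)))

  -- The pattern of most estimates below: a certificate `d` assembled from nonnegative pieces, and a
  -- ring identity left to the solver.
  ≤-by : ∀ {x y d} → 0# ≤ d → y - x ≈ d → x ≤ y
  ≤-by {x} {y} 0≤d eq y<x = 0≤d (<-respˡ-≈ eq (<-respʳ-≈ (-‿inverseʳ x) (+-monoˡ-< (- x) y<x)))

  +-mono-≤ : ∀ {x y u v} → x ≤ y → u ≤ v → x + u ≤ y + v
  +-mono-≤ {x} {y} {u} {v} x≤y u≤v = ≤-trans {j = y + u}
    (≤-by (≤-diff x≤y) (solve 3 (λ x y u → (y :+ u) :- (x :+ u) := y :- x) refl x y u))
    (≤-by (≤-diff u≤v) (solve 3 (λ y u v → (y :+ v) :- (y :+ u) := v :- u) refl y u v))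

  0≤-+ : ∀ {x y} → 0# ≤ x → 0# ≤ y → 0# ≤ x + y
  0≤-+ 0≤x 0≤y = ≤-respˡ-≈ (+-identityˡ 0#) (+-mono-≤ 0≤x 0≤y)

  0<-+ : ∀ {x y} → 0# < x → 0# ≤ y → 0# < x + y
  0<-+ {x} {y} 0<x 0≤y = <-≤-trans 0<x (≤-respˡ-≈ (+-identityʳ x) (+-mono-≤ ≤-refl 0≤y))

  0≤-* : ∀ {x y} → 0# ≤ x → 0# ≤ y → 0# ≤ x * y
  0≤-* {x} {y} 0≤x 0≤y =
    by-cases 0# x
      (λ 0<x → by-cases 0# y
        (λ 0<y → <⇒≤ (*-pos 0<x 0<y))
        (λ y≤0 → ≤-reflexive (trans (sym (zeroʳ x)) (*-congˡ (antisym 0≤y y≤0)))))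
      (λ x≤0 → ≤-reflexive (trans (sym (zeroˡ y)) (*-congʳ (antisym 0≤x x≤0))))

  0≤-square : ∀ x → 0# ≤ x * x
  0≤-square x = by-cases 0# x
    (λ 0<x → <⇒≤ (*-pos 0<x 0<x))
    (λ x≤0 → ≤-respʳ-≈ (solve 1 (λ x → (con (+ 0) :- x) :* (con (+ 0) :- x) := x :* x) refl x)
      (0≤-* (≤-diff x≤0) (≤-diff x≤0)))

  *-cancelʳ-≤ : ∀ {x y z} → 0# < z → x * z ≤ y * z → x ≤ y
  *-cancelʳ-≤ {x} {y} {z} 0<z xz≤yz y<x = xz≤yz
    (<-by (*-pos (<-diff y<x) 0<z) (solve 3 (λ x y z → x :* z :- y :* z := (x :- y) :* z) refl x y z))

  *-monoʳ-≤ : ∀ {x y z} → 0# ≤ z → x ≤ y → z * x ≤ z * y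
  *-monoʳ-≤ {x} {y} {z} 0≤z x≤y = ≤-by (0≤-* 0≤z (≤-diff x≤y))
    (solve 3 (λ x y z → z :* y :- z :* x := z :* (y :- x)) refl x y z)

  *-monoˡ-≤ : ∀ {x y z} → 0# ≤ z → x ≤ y → x * z ≤ y * z
  *-monoˡ-≤ 0≤z x≤y = ≤-respˡ-≈ (*-comm _ _) (≤-respʳ-≈ (*-comm _ _) (*-monoʳ-≤ 0≤z x≤y))

  0≤fromℕ : ∀ n → 0# ≤ fromℕ n
  0≤fromℕ ℕ.zero    = ≤-refl
  0≤fromℕ (ℕ.suc n) = <⇒≤ (0<1+n n)

  fromℕ-mono-≤ : ∀ {m n} → m ℕ.≤ n → fromℕ m ≤ fromℕ n
  fromℕ-mono-≤ {n = n} ℕ.z≤n = 0≤fromℕ n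
  fromℕ-mono-≤ (ℕ.s≤s m≤n)   = +-mono-≤ ≤-refl (fromℕ-mono-≤ m≤n)

  proj₁-fromℕ⁺ : ∀ n .{{_ : ℕ.NonZero n}} → proj₁ (fromℕ⁺ n) ≈ fromℕ n
  proj₁-fromℕ⁺ (ℕ.suc n) = refl

  -- If no such `n` existed, induction would show that no `fromℕ n` exceeds `x`, against the
  -- Archimedean axiom.
  floor-exists : ∀ {x} → 0# ≤ x → ¬ ¬ (∃[ n ] (fromℕ n ≤ x × x < fromℕ (ℕ.suc n)))
  floor-exists {x} 0≤x ¬∃ = below (proj₁ (archimedean x)) (proj₂ (archimedean x))
    where
    below : ∀ n → ¬ (x < fromℕ n)
    below ℕ.zero    = 0≤x
    below (ℕ.suc n) x<1+n = ¬∃ (n , below n , x<1+n)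

  -- Finite sums and basis vectors

  sum-mono-≤ : ∀ {n} {f g : Vector Carrier n} → (∀ i → f i ≤ g i) → sum f ≤ sum g
  sum-mono-≤ {ℕ.zero}  f≤g = ≤-refl
  sum-mono-≤ {ℕ.suc n} f≤g = +-mono-≤ (f≤g Fin.zero) (sum-mono-≤ (λ i → f≤g (Fin.suc i)))

  0≤-sum : ∀ {n} {f : Vector Carrier n} → (∀ i → 0# ≤ f i) → 0# ≤ sum f
  0≤-sum {ℕ.zero}  0≤f = ≤-refl
  0≤-sum {ℕ.suc n} 0≤f = 0≤-+ (0≤f Fin.zero) (0≤-sum (λ i → 0≤f (Fin.suc i)))

  ≤-sum : ∀ {n} {f : Vector Carrier n} → (∀ i → 0# ≤ f i) → ∀ i → f i ≤ sum f
  ≤-sum 0≤f Fin.zero    = ≤-respˡ-≈ (+-identityʳ _) (+-mono-≤ ≤-refl (0≤-sum (λ i → 0≤f (Fin.suc i))))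
  ≤-sum 0≤f (Fin.suc i) = ≤-respˡ-≈ (+-identityˡ _) (+-mono-≤ (0≤f Fin.zero) (≤-sum (λ j → 0≤f (Fin.suc j)) i))

  ∑-distrib-minus : ∀ {n} (f g : Vector Carrier n) → sum (λ i → f i - g i) ≈ sum f - sum g
  ∑-distrib-minus {ℕ.zero}  f g = sym (-‿inverseʳ 0#)
  ∑-distrib-minus {ℕ.suc n} f g = trans (+-congˡ (∑-distrib-minus (λ i → f (Fin.suc i)) (λ i → g (Fin.suc i))))
    (solve 4 (λ a b s t → (a :- b) :+ (s :- t) := (a :+ s) :- (b :+ t)) refl _ _ _ _)

  sum-const : ∀ n x → sum {n} (λ _ → x) ≈ fromℕ n * x
  sum-const n x = begin
    sum {n} (λ _ → x)  ≈⟨ sum-replicate n ⟩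
    n · x              ≈⟨ ·-congʳ n (*-identityˡ x) ⟨
    n · (1# * x)       ≈⟨ ×-assoc-* n 1# x ⟨
    fromℕ n * x        ∎
    where
    open ≈-Reasoning setoid
    ·-congʳ : ∀ m {y z} → y ≈ z → m · y ≈ m · z
    ·-congʳ = SemiringMult.×-congʳ (CommutativeRing.semiring commutativeRing)

  basis : ∀ {n} → Fin n → Vector Carrier n
  basis Fin.zero    Fin.zero    = 1#
  basis Fin.zero    (Fin.suc j) = 0#
  basis (Fin.suc i) Fin.zero    = 0#
  basis (Fin.suc i) (Fin.suc j) = basis i j

  0≤basis : ∀ {n} (i j : Fin n) → 0# ≤ basis i j
  0≤basis Fin.zero    Fin.zero    = <⇒≤ 0<1
  0≤basis Fin.zero    (Fin.suc j) = ≤-refl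
  0≤basis (Fin.suc i) Fin.zero    = ≤-refl
  0≤basis (Fin.suc i) (Fin.suc j) = 0≤basis i j

  basis-≡ : ∀ {n} (i : Fin n) → basis i i ≈ 1#
  basis-≡ Fin.zero    = refl
  basis-≡ (Fin.suc i) = basis-≡ i

  basis-≢ : ∀ {n} {i j : Fin n} → ¬ i ≡ j → basis i j ≈ 0#
  basis-≢ {i = Fin.zero}  {Fin.zero}  i≢j = contradiction ≡.refl i≢j
  basis-≢ {i = Fin.zero}  {Fin.suc j} i≢j = refl
  basis-≢ {i = Fin.suc i} {Fin.zero}  i≢j = refl
  basis-≢ {i = Fin.suc i} {Fin.suc j} i≢j = basis-≢ (λ i≡j → i≢j (≡.cong Fin.suc i≡j))

  sum-zero : ∀ {n} {f : Vector Carrier n} → (∀ i → f i ≈ 0#) → sum f ≈ 0#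
  sum-zero {ℕ.zero}  f≈0 = refl
  sum-zero {ℕ.suc n} f≈0 = trans (+-cong (f≈0 Fin.zero) (sum-zero (λ i → f≈0 (Fin.suc i)))) (+-identityˡ 0#)

  sum-basis-* : ∀ {n} (i : Fin n) (f : Vector Carrier n) → sum (λ j → basis i j * f j) ≈ f i
  sum-basis-* Fin.zero    f = trans
    (+-cong (*-identityˡ _) (sum-zero (λ j → zeroˡ (f (Fin.suc j))))) (+-identityʳ _)
  sum-basis-* (Fin.suc i) f = trans
    (+-cong (zeroˡ _) (sum-basis-* i (λ j → f (Fin.suc j)))) (+-identityˡ _)

  sum-basis : ∀ {n} (i : Fin n) → sum (basis i) ≈ 1#
  sum-basis i = trans (sum-cong-≋ (λ j → sym (*-identityʳ (basis i j)))) (sum-basis-* i (λ _ → 1#))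

  -- Exponential and logarithm

  exp-split : ∀ x y → exp y ≈ exp x * exp (y - x)
  exp-split x y = trans (exp-cong (solve 2 (λ x y → y := x :+ (y :- x)) refl x y)) (exp-+ x (y - x))

  -- For `z = y - x`, `exp y - exp x = exp x * (exp z - 1)`, which is at least `exp x * z`.
  exp-mono-≤ : ∀ {x y} → x ≤ y → exp x ≤ exp y
  exp-mono-≤ {x} {y} x≤y = ≤-by
    (0≤-* (<⇒≤ (exp-pos x)) (0≤-+ (≤-diff (1+x≤exp (y - x))) (≤-diff x≤y)))
    (trans (+-congʳ (exp-split x y))
      (solve 4 (λ e f x y → e :* f :- e := e :* ((f :- (con (+ 1) :+ (y :- x))) :+ (y :- x)))
        refl (exp x) (exp (y - x)) x y))

  exp-cancel-≤ : ∀ {x y} → exp x ≤ exp y → x ≤ y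
  exp-cancel-≤ {x} {y} ex≤ey y<x = ex≤ey (<-by
    (*-pos (exp-pos y) (0<-+ (<-diff y<x) (≤-diff (1+x≤exp (x - y)))))
    (trans (+-congʳ (exp-split y x))
      (solve 4 (λ e f x y → e :* f :- e := e :* ((x :- y) :+ (f :- (con (+ 1) :+ (x :- y)))))
        refl (exp y) (exp (x - y)) x y)))

  exp-injective : ∀ {x y} → exp x ≈ exp y → x ≈ y
  exp-injective eq = antisym (exp-cancel-≤ (≤-reflexive eq)) (exp-cancel-≤ (≤-reflexive (sym eq)))

  exp-0 : exp 0# ≈ 1#
  exp-0 = antisym
    (*-cancelʳ-≤ (exp-pos 0#) (≤-reflexive (trans (sym (exp-+ 0# 0#))
      (trans (exp-cong (+-identityˡ 0#)) (sym (*-identityˡ _))))))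
    (≤-respˡ-≈ (+-identityʳ 1#) (1+x≤exp 0#))

  exp-inverse : ∀ x → exp x * exp (- x) ≈ 1#
  exp-inverse x = trans (sym (exp-+ x (- x))) (trans (exp-cong (-‿inverseʳ x)) exp-0)

  -- Injectivity of `exp` determines the logarithm; in particular its value does not depend on the
  -- positivity proof inside `x`.
  ln-unique : ∀ {x : R⁺} {z} → exp z ≈ proj₁ x → ln x ≈ z
  ln-unique {x} eq = exp-injective (trans (exp-ln x) (sym eq))

  ln-mono-≤ : ∀ {x y : R⁺} → proj₁ x ≤ proj₁ y → ln x ≤ ln y
  ln-mono-≤ {x} {y} x≤y = exp-cancel-≤ (≤-respˡ-≈ (sym (exp-ln x)) (≤-respʳ-≈ (sym (exp-ln y)) x≤y))

  ln-* : ∀ x y → ln (x *⁺ y) ≈ ln x + ln y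
  ln-* x y = ln-unique (trans (exp-+ (ln x) (ln y)) (*-cong (exp-ln x) (exp-ln y)))

  /-cancel : ∀ x y → (x / y) * proj₁ y ≈ x
  /-cancel x y = trans (*-assoc x (y ⁻¹) (proj₁ y))
    (trans (*-congˡ (trans (*-comm _ _) (⁻¹-inverseʳ y))) (*-identityʳ x))

  ln-/ : ∀ x y → ln (x /⁺ y) ≈ ln x - ln y
  ln-/ x y = trans
    (solve 2 (λ a b → a := (a :+ b) :- b) refl (ln (x /⁺ y)) (ln y))
    (+-congʳ (sym (ln-unique (trans (exp-+ _ _)
      (trans (*-cong (exp-ln (x /⁺ y)) (exp-ln y)) (/-cancel (proj₁ x) y))))))

  ln-exp : ∀ {z} (0<e : 0# < exp z) → ln (exp z , 0<e) ≈ z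
  ln-exp 0<e = ln-unique refl

  -- Convexity of `exp` as its tangent line at `ln p`: the axiom at base point 0, rescaled by
  -- `p = exp (ln p)`.
  tangent : ∀ (p : R⁺) z → proj₁ p * (1# + (z - ln p)) ≤ exp z
  tangent p z = ≤-respʳ-≈ (trans (*-congʳ (sym (exp-ln p))) (sym (exp-split (ln p) z)))
    (*-monoʳ-≤ (<⇒≤ (proj₂ p)) (1+x≤exp (z - ln p)))

  -- Lets the solver use a hypothesis `a ≈ b`: the identity is stated with an explicit multiple of
  -- `a - b`, which is then discarded.
  ≈-modulo : ∀ {a b} x k → a ≈ b → x + k * (a - b) ≈ x
  ≈-modulo {a} {b} x k a≈b = trans (+-congˡ (trans (*-congˡ (trans (+-congʳ a≈b) (-‿inverseʳ b))) (zeroʳ k)))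
    (+-identityʳ x)

  ≤-/⇒*-≤ : ∀ {x y z} → x ≤ y / z → proj₁ z * x ≤ y
  ≤-/⇒*-≤ {y = y} {z} x≤y/z = ≤-respʳ-≈ (trans (*-comm _ _) (/-cancel y z)) (*-monoʳ-≤ (<⇒≤ (proj₂ z)) x≤y/z)

  -- The pointwise form of KL ≤ χ².
  x·ln[x/p]≤ : ∀ x p → proj₁ x * (ln x - ln p) ≤
    (proj₁ x - proj₁ p) * (proj₁ x - proj₁ p) * p ⁻¹ + (proj₁ x - proj₁ p)
  -- The certificate is `x / p` times the tangent inequality `p (1 + ln x - ln p) ≤ x`.
  x·ln[x/p]≤ x p = ≤-by
    (0≤-* (<⇒≤ (*-pos (proj₂ x) (⁻¹-pos p)))
          (≤-diff (≤-respʳ-≈ (exp-ln x) (tangent p (ln x)))))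
    (trans (solve 4 (λ x p q a →
        ((x :- p) :* (x :- p) :* q :+ (x :- p)) :- x :* a :=
        x :* q :* (x :- p :* (con (+ 1) :+ a)) :+ (p :- x :+ x :* a) :* (p :* q :- con (+ 1)))
      refl (proj₁ x) (proj₁ p) (p ⁻¹) (ln x - ln p))
    (≈-modulo _ _ (⁻¹-inverseʳ p)))

-- First-order conditions for the entropy projection

module Projection {c ℓ₁ ℓ₂} (R : Reals c ℓ₁ ℓ₂) (N : ℕ) (2≤N : 2 ℕ.≤ N) where

  open Reals R
  open RealProperties R
  open SharedResource R N 2≤N

  lnΔ : ∀ {ε} → Δ ε → Vector Carrier N
  lnΔ p i = ln (coord⁺ p i)

  sum-diff : ∀ {ε} (u p : Δ ε) → sum (λ i → coord u i - coord p i) ≈ 0#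
  sum-diff u p = trans (∑-distrib-minus (coord u) (coord p))
    (trans (+-cong (Δ.sum≈1 u) (-‿cong (Δ.sum≈1 p))) (-‿inverseʳ 1#))

  relativeEntropy-ln : ∀ x y → relativeEntropy x y ≈ sum (λ i → proj₁ (x i) * (ln (x i) - ln (y i)))
  relativeEntropy-ln x y = sum-cong-≋ (λ i → *-congˡ (ln-/ (x i) (y i)))

  mix : ∀ {ε} θ → 0# ≤ θ → θ ≤ 1# → (p u : Δ ε) → Δ ε
  mix θ 0≤θ θ≤1 p u = record
    { coord = λ i → coord p i + θ * (coord u i - coord p i)
    ; sum≈1 = trans (∑-distrib-+ (coord p) _)
        (trans (+-cong (Δ.sum≈1 p) (trans (sym (*-distribˡ-sum θ (λ i → coord u i - coord p i)))
                                          (trans (*-congˡ (sum-diff u p)) (zeroʳ θ))))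
               (+-identityʳ 1#))
    ; lower = λ i → ≤-by
        (0≤-+ (0≤-* (≤-diff θ≤1) (≤-diff (Δ.lower p i))) (0≤-* 0≤θ (≤-diff (Δ.lower u i))))
        (solve 4 (λ θ p u m → (p :+ θ :* (u :- p)) :- m :=
            (con (+ 1) :- θ) :* (p :- m) :+ θ :* (u :- m))
          refl θ (coord p i) (coord u i) _)
    }

  module _ {ε : R⁺} {y : Vector R⁺ N} {p : Δ ε} (projection : IsProjection ε y p) where

    -- The derivative of `x log (x / y)` at `p` without its constant 1, which cancels because
    -- differences of points of `Δ ε` sum to 0.
    gradient : Vector Carrier N
    gradient i = lnΔ p i - ln (y i)

    -- If the directional derivative `S` towards `u` were negative, a step `θ` that way would change
    -- the objective by at most `θ S + θ² C`. This equals `- θ² D` for the chosen `θ`, against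
    -- minimality of `p`.
    variational : (u : Δ ε) → 0# ≤ sum (λ i → (coord u i - coord p i) * gradient i)
    variational u S<0 = ≤-trans F-p≤F-x F-x≤ (<-by (*-pos 0<θ (*-pos 0<θ 0<D))
        (trans (solve 4 (λ f θ S C → f :- (f :+ (θ :* S :+ θ :* θ :* C)) :=
                    θ :* (θ :* (con (+ 0) :- S)) :+ :- θ :* (θ :* ((con (+ 0) :- S) :+ C) :- (con (+ 0) :- S)))
                  refl (F p) θ S C)
               (≈-modulo _ _ (/-cancel D D+C))))
      where
      d χ : Vector Carrier N
      d i = coord u i - coord p i
      χ i = d i * d i * coord⁺ p i ⁻¹

      S C D : Carrier
      S = sum (λ i → d i * gradient i)
      C = sum χ
      D = 0# - S

      0<D : 0# < D
      0<D = <-diff S<0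

      0≤C : 0# ≤ C
      0≤C = 0≤-sum (λ i → 0≤-* (0≤-square (d i)) (<⇒≤ (⁻¹-pos (coord⁺ p i))))

      D+C : R⁺
      D+C = D + C , 0<-+ 0<D 0≤C

      -- Small enough for the linear gain `θ D` to beat the quadratic cost `θ² C`. The summand `D`
      -- in the denominator keeps it positive and gives `θ ≤ 1`.
      θ : Carrier
      θ = D / D+C

      0<θ : 0# < θ
      0<θ = *-pos 0<D (⁻¹-pos D+C)

      θ≤1 : θ ≤ 1#
      θ≤1 = *-cancelʳ-≤ (proj₂ D+C) (≤-by 0≤C
        (trans (+-cong (*-identityˡ _) (-‿cong (/-cancel D D+C)))
               (solve 2 (λ D C → (D :+ C) :- D := C) refl D C)))

      x : Δ ε
      x = mix θ (<⇒≤ 0<θ) θ≤1 p u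

      F : Δ ε → Carrier
      F v = sum (λ i → coord v i * (lnΔ v i - ln (y i)))

      F-p≤F-x : F p ≤ F x
      F-p≤F-x = ≤-respˡ-≈ (relativeEntropy-ln (coord⁺ p) y)
        (≤-respʳ-≈ (relativeEntropy-ln (coord⁺ x) y) (projection x))

      -- The χ² bound applied to `x i - p i = θ d i`. Its linear term `θ d i` vanishes in the sum.
      pointwise : ∀ i → coord x i * (lnΔ x i - ln (y i)) ≤
        coord p i * gradient i + (θ * (d i * gradient i) + θ * θ * χ i + θ * d i)
      pointwise i = ≤-by (≤-diff (x·ln[x/p]≤ (coord⁺ x i) (coord⁺ p i)))
        (solve 7 (λ p d θ q lx lp ly →
          (p :* (lp :- ly) :+ (θ :* (d :* (lp :- ly)) :+ θ :* θ :* (d :* d :* q) :+ θ :* d))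
            :- (p :+ θ :* d) :* (lx :- ly) :=
          (((p :+ θ :* d) :- p) :* ((p :+ θ :* d) :- p) :* q :+ ((p :+ θ :* d) :- p))
            :- (p :+ θ :* d) :* (lx :- lp))
        refl (coord p i) (d i) θ (coord⁺ p i ⁻¹) (lnΔ x i) (lnΔ p i) (ln (y i)))

      F-x≤ : F x ≤ F p + (θ * S + θ * θ * C)
      F-x≤ = ≤-respʳ-≈
        (trans (∑-distrib-+ (λ i → coord p i * gradient i) _)
          (+-congˡ (trans (∑-distrib-+ (λ i → θ * (d i * gradient i) + θ * θ * χ i) _)
            (trans (+-cong
              (trans (∑-distrib-+ (λ i → θ * (d i * gradient i)) _)
                (+-cong (sym (*-distribˡ-sum θ (λ i → d i * gradient i))) (sym (*-distribˡ-sum (θ * θ) χ))))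
              (trans (sym (*-distribˡ-sum θ d)) (trans (*-congˡ (sum-diff u p)) (zeroʳ θ))))
            (+-identityʳ _)))))
        (sum-mono-≤ pointwise)

    -- If coordinate j dropped by more than the factor e^{-c}, some other
    -- coordinate k grew, and moving the growth of k back to j would decrease
    -- the relative entropy.
    ln-drop≤ : (h : Δ ε) (c : Carrier) →
      (∀ i → lnΔ h i ≤ ln (y i)) → (∀ i → ln (y i) ≤ lnΔ h i + c) →
      ∀ j → lnΔ h j - c ≤ lnΔ p j
    ln-drop≤ h c lnh≤lny lny≤lnh+c j dropped = none-grew (λ k → grew k)
      where
      -- Both points have total mass 1, so if no coordinate grew then none fell. But coordinate `j`
      -- fell, since `c` is nonnegative by the two bounds on `ln y`.
      none-grew : ¬ (∀ k → coord p k ≤ coord h k)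
      none-grew p≤h = ≤-trans
        (≤-by (≤-diff (≤-trans (lnh≤lny j) (lny≤lnh+c j)))
              (solve 2 (λ l c → l :- (l :- c) := (l :+ c) :- l) refl (lnΔ h j) c))
        (ln-mono-≤ {coord⁺ h j} {coord⁺ p j}
          (≤-by (≤-diff (≤-respʳ-≈ (sum-diff h p) (≤-sum (λ k → ≤-diff (p≤h k)) j)))
                (solve 2 (λ h p → p :- h := con (+ 0) :- (h :- p)) refl (coord h j) (coord p j))))
        dropped

      grew : ∀ k → ¬ (coord h k < coord p k)
      grew k h<p = ≤-respʳ-≈ S≈ (variational u) (<-by (*-pos (<-diff h<p) φj<φk)
          (solve 3 (λ m a b → con (+ 0) :- m :* (a :- b) := m :* (b :- a)) refl m (gradient j) (gradient k)))
        where
        m : Carrier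
        m = coord p k - coord h k

        -- Moving the mass `m` out of coordinate `k` leaves at least `h k` there, so `u` stays above
        -- `ε / N`.
        u : Δ ε
        u = record
          { coord = λ l → coord p l + m * (basis j l - basis k l)
          ; sum≈1 = trans (∑-distrib-+ (coord p) _)
              (trans (+-cong (Δ.sum≈1 p)
                (trans (sym (*-distribˡ-sum m (λ l → basis j l - basis k l)))
                  (trans (*-congˡ (trans (∑-distrib-minus (basis j) (basis k))
                    (trans (+-cong (sum-basis j) (-‿cong (sum-basis k))) (-‿inverseʳ 1#)))) (zeroʳ m))))
              (+-identityʳ 1#))
          ; lower = λ l → ≤-trans (lower l) (≤-by (0≤-* (<⇒≤ (<-diff h<p)) (0≤basis j l))
              (solve 4 (λ p m b b′ → (p :+ m :* (b :- b′)) :- (p :- m :* b′) := m :* b)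
                refl (coord p l) m (basis j l) (basis k l)))
          }
          where
          lower : ∀ l → proj₁ ε / N⁺ ≤ coord p l - m * basis k l
          lower l with k Fin.≟ l
          ... | yes ≡.refl = ≤-respʳ-≈
            (sym (trans (+-congˡ (-‿cong (trans (*-congˡ (basis-≡ k)) (*-identityʳ m))))
                        (solve 2 (λ p h → p :- (p :- h) := h) refl (coord p k) (coord h k))))
            (Δ.lower h k)
          ... | no k≢l = ≤-respʳ-≈
            (sym (trans (+-congˡ (-‿cong (trans (*-congˡ (basis-≢ k≢l)) (zeroʳ m))))
                        (solve 1 (λ p → p :- con (+ 0) := p) refl (coord p l))))
            (Δ.lower p l)

        S≈ : sum (λ l → (coord u l - coord p l) * gradient l) ≈ m * (gradient j - gradient k)
        S≈ = trans
          (sum-cong-≋ (λ l → solve 5 (λ p m b b′ g →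
              ((p :+ m :* (b :- b′)) :- p) :* g := m :* (b :* g :- b′ :* g))
            refl (coord p l) m (basis j l) (basis k l) (gradient l)))
          (trans (sym (*-distribˡ-sum m (λ l → basis j l * gradient l - basis k l * gradient l)))
            (*-congˡ (trans (∑-distrib-minus (λ l → basis j l * gradient l) (λ l → basis k l * gradient l))
              (+-cong (sum-basis-* j gradient) (-‿cong (sum-basis-* k gradient))))))

        -- The gradient is below `- c` at `j`, where `ln p` fell by more than `c` and `ln h ≤ ln y`.
        -- It is at least `- c` at `k`, where `p` exceeds `h` and `ln y ≤ ln h + c`.
        φj<φk : 0# < gradient k - gradient j
        φj<φk = <-respʳ-≈
          (solve 7 (λ hj c pj hk pk yj yk →
            ((hj :- c) :- pj) :+ ((yj :- hj) :+ (((hk :+ c) :- yk) :+ (pk :- hk))) :=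
            (pk :- yk) :- (pj :- yj))
          refl (lnΔ h j) c (lnΔ p j) (lnΔ h k) (lnΔ p k) (ln (y j)) (ln (y k)))
          (0<-+ (<-diff dropped) (0≤-+ (≤-diff (lnh≤lny j)) (0≤-+ (≤-diff (lny≤lnh+c k))
            (≤-diff (ln-mono-≤ {coord⁺ h k} {coord⁺ p k} (<⇒≤ h<p))))))

    -- The variational inequality replaces `u` by `p`. The tangent at `ln (p i)` then bounds
    -- `p i * gradient i` below by `p i - h i + r i - c * p i`, and the masses of `p` and `h` cancel
    -- in the sum.
    progress : (h : Δ ε) (c : Carrier) (r : Vector Carrier N) →
      (∀ i → exp (ln (y i) - c) ≤ coord h i - r i) →
      ∀ (u : Δ ε) → sum r - c ≤ sum (λ i → coord u i * gradient i)
    progress h c r bound u = ≤-trans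
      (≤-respˡ-≈ sum≈ (sum-mono-≤ pointwise))
      (≤-by (variational u) (trans (sym (∑-distrib-minus (λ i → coord u i * gradient i) (λ i → coord p i * gradient i)))
        (sum-cong-≋ (λ i → solve 3 (λ u p g → u :* g :- p :* g := (u :- p) :* g)
          refl (coord u i) (coord p i) (gradient i)))))
      where
      pointwise : ∀ i → ((coord p i - coord h i) + r i) - c * coord p i ≤ coord p i * gradient i
      pointwise i = ≤-by (≤-diff (≤-trans (tangent (coord⁺ p i) (ln (y i) - c)) (bound i)))
        (solve 6 (λ p h r c lp ly →
          p :* (lp :- ly) :- (((p :- h) :+ r) :- c :* p) :=
          (h :- r) :- p :* (con (+ 1) :+ ((ly :- c) :- lp)))
        refl (coord p i) (coord h i) (r i) c (lnΔ p i) (ln (y i)))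

      sum≈ : sum (λ i → ((coord p i - coord h i) + r i) - c * coord p i) ≈ sum r - c
      sum≈ = trans (∑-distrib-minus (λ i → (coord p i - coord h i) + r i) (λ i → c * coord p i))
        (+-cong
          (trans (∑-distrib-+ (λ i → coord p i - coord h i) r) (trans (+-congʳ (sum-diff p h)) (+-identityˡ _)))
          (-‿cong (trans (sym (*-distribˡ-sum c (coord p))) (trans (*-congˡ (Δ.sum≈1 p)) (*-identityʳ c)))))

-- Conservation and decay of queues

module Queues {c ℓ₁ ℓ₂} (R : Reals c ℓ₁ ℓ₂) (N : ℕ) (2≤N : 2 ℕ.≤ N) where

  open Reals R
  open RealProperties R
  open SharedResource R N 2≤N

  0≤Q : ∀ L h t i → 0# ≤ Q L h t i
  0≤Q L h 0                     i = ≤-refl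
  0≤Q L h 1                     i = ≤-refl
  0≤Q L h (ℕ.suc (ℕ.suc t)) i = x≤x∨y _ _

  -- Conservation of work: `min a z + max 0 (z - a) = z`. Splitting by `antisym` makes each half a
  -- negation, so that `a` and `z` may be compared.
  w+Q≈L+Q : ∀ L h t i →
    w L h (ℕ.suc t) i + Q L h (ℕ.suc (ℕ.suc t)) i ≈ L (ℕ.suc t) i + Q L h (ℕ.suc t) i
  w+Q≈L+Q L h t i = antisym
    (by-cases a z
      (λ a<z → ≤-trans (+-mono-≤ (x∧y≤x a z) (∨-least (<⇒≤ (<-diff a<z)) ≤-refl))
        (≤-reflexive (solve 2 (λ a z → a :+ (z :- a) := z) refl a z)))
      (λ z≤a → ≤-trans (+-mono-≤ (x∧y≤y a z) (∨-least ≤-refl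
          (≤-by (≤-diff z≤a) (solve 2 (λ a z → con (+ 0) :- (z :- a) := a :- z) refl a z))))
        (≤-reflexive (+-identityʳ z))))
    (by-cases a z
      (λ a<z → ≤-respˡ-≈ (solve 2 (λ a z → a :+ (z :- a) := z) refl a z)
        (+-mono-≤ (∧-greatest ≤-refl (<⇒≤ a<z)) (y≤x∨y 0# (z - a))))
      (λ z≤a → ≤-respˡ-≈ (+-identityʳ z) (+-mono-≤ (∧-greatest z≤a ≤-refl) (x≤x∨y 0# (z - a)))))
    where
    a z : Carrier
    a = h (ℕ.suc t) i
    z = L (ℕ.suc t) i + Q L h (ℕ.suc t) i

  totalLoad : Loads → ℕ → Carrier
  totalLoad L ℕ.zero    = 0#
  totalLoad L (ℕ.suc t) = totalLoad L t + sum (L (ℕ.suc t))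

  work+ΣQ≈load : ∀ L h t → work L h t + sum (Q L h (ℕ.suc t)) ≈ totalLoad L t
  work+ΣQ≈load L h ℕ.zero    = trans (+-identityˡ _) (sum-zero {N} (λ _ → refl))
  work+ΣQ≈load L h (ℕ.suc t) = begin
    (work L h t + sum (w L h 1+t)) + sum (Q L h (ℕ.suc 1+t))   ≈⟨ +-assoc _ _ _ ⟩
    work L h t + (sum (w L h 1+t) + sum (Q L h (ℕ.suc 1+t)))   ≈⟨ +-congˡ (∑-distrib-+ (w L h 1+t) (Q L h (ℕ.suc 1+t))) ⟨
    work L h t + sum (λ i → w L h 1+t i + Q L h (ℕ.suc 1+t) i) ≈⟨ +-congˡ (sum-cong-≋ (w+Q≈L+Q L h t)) ⟩
    work L h t + sum (λ i → L 1+t i + Q L h 1+t i)             ≈⟨ +-congˡ (∑-distrib-+ (L 1+t) (Q L h 1+t)) ⟩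
    work L h t + (sum (L 1+t) + sum (Q L h 1+t))
      ≈⟨ solve 3 (λ a b c → a :+ (b :+ c) := (a :+ c) :+ b) refl _ _ _ ⟩
    (work L h t + sum (Q L h 1+t)) + sum (L 1+t)               ≈⟨ +-congʳ (work+ΣQ≈load L h t) ⟩
    totalLoad L t + sum (L 1+t)                                ∎
    where
    open ≈-Reasoning setoid
    1+t : ℕ
    1+t = ℕ.suc t

  -- Both allocation sequences face the same total load, so their works differ by the difference of
  -- their queues, and the queues of `h′` are nonnegative.
  work-diff≤ΣQ : ∀ L h h′ t → work L h′ t - work L h t ≤ sum (Q L h (ℕ.suc t))
  work-diff≤ΣQ L h h′ t = ≤-by (0≤-sum (0≤Q L h′ (ℕ.suc t)))
    (trans (solve 4 (λ w q w′ q′ → q :- (w′ :- w) := q′ :+ con (+ 1) :* ((w :+ q) :- (w′ :+ q′)))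
        refl (work L h t) (sum (Q L h (ℕ.suc t))) (work L h′ t) (sum (Q L h′ (ℕ.suc t))))
      (≈-modulo _ _ (trans (work+ΣQ≈load L h t) (sym (work+ΣQ≈load L h′ t)))))

  -- Had the demand been below the allocation, the next queue would be empty.
  full-use : ∀ L h t i → 0# < Q L h (ℕ.suc (ℕ.suc t)) i → h (ℕ.suc t) i ≤ w L h (ℕ.suc t) i
  full-use L h t i 0<Q = ∧-greatest ≤-refl (λ z<a → ∨-least ≤-refl
    (≤-by (≤-diff (<⇒≤ z<a)) (solve 2 (λ a z → con (+ 0) :- (z :- a) := a :- z) refl _ _)) 0<Q)

  module _ {L : Loads} {h : Allocations} where

    0≤w : ∀ t i → 0# ≤ L t i → 0# ≤ h t i → 0# ≤ w L h t i
    0≤w t i 0≤L 0≤h = ∧-greatest 0≤h (0≤-+ 0≤L (0≤Q L h t i))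

    Q-step : ∀ t i → 0# ≤ L (ℕ.suc t) i → h (ℕ.suc t) i ≤ 1# →
      Q L h (ℕ.suc t) i ≤ 1# + Q L h (ℕ.suc (ℕ.suc t)) i
    Q-step t i 0≤L h≤1 = ≤-by
      (0≤-+ (≤-diff (y≤x∨y 0# (L (ℕ.suc t) i + Q L h (ℕ.suc t) i - h (ℕ.suc t) i))) (0≤-+ 0≤L (≤-diff h≤1)))
      (solve 4 (λ l q a q′ → (con (+ 1) :+ q′) :- q := (q′ :- ((l :+ q) :- a)) :+ (l :+ (con (+ 1) :- a)))
        refl (L (ℕ.suc t) i) (Q L h (ℕ.suc t) i) (h (ℕ.suc t) i) (Q L h (ℕ.suc (ℕ.suc t)) i))

    Q-decay : ∀ k a i → (∀ t → 1 ℕ.≤ t → t ℕ.≤ k ℕ.+ a → 0# ≤ L t i) →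
      (∀ t → 1 ℕ.≤ t → t ℕ.≤ k ℕ.+ a → h t i ≤ 1#) →
      Q L h (ℕ.suc a) i ≤ fromℕ k + Q L h (ℕ.suc (k ℕ.+ a)) i
    Q-decay ℕ.zero    a i 0≤L h≤1 = ≤-reflexive (sym (+-identityˡ _))
    Q-decay (ℕ.suc k) a i 0≤L h≤1 = ≤-trans
      (Q-decay k a i (λ t 1≤t t≤k+a → 0≤L t 1≤t (m≤n⇒m≤1+n t≤k+a))
                     (λ t 1≤t t≤k+a → h≤1 t 1≤t (m≤n⇒m≤1+n t≤k+a)))
      (≤-respʳ-≈ (solve 2 (λ k q → k :+ (con (+ 1) :+ q) := (con (+ 1) :+ k) :+ q) refl (fromℕ k) _)
        (+-mono-≤ ≤-refl (Q-step (k ℕ.+ a) i (0≤L _ (ℕ.s≤s ℕ.z≤n) ℕₚ.≤-refl)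
                                             (h≤1 _ (ℕ.s≤s ℕ.z≤n) ℕₚ.≤-refl))))

-- Analysis of an execution: numerical constants

module Analysis {c ℓ₁ ℓ₂} (R : Reals c ℓ₁ ℓ₂) (N : ℕ) (2≤N : 2 ℕ.≤ N) where

  open Reals R
  open RealProperties R
  open SharedResource R N 2≤N
  open Projection R N 2≤N
  open Queues R N 2≤N

  coord≤1 : ∀ {ε} (p : Δ ε) i → coord p i ≤ 1#
  coord≤1 p i = ≤-respʳ-≈ (Δ.sum≈1 p) (≤-sum (λ j → <⇒≤ (Δ.coord-pos p j)) i)

  N⁺≈N : proj₁ N⁺ ≈ fromℕ N
  N⁺≈N = proj₁-fromℕ⁺ N {{ℕ.>-nonZero (ℕₚ.≤-trans (ℕₚ.n≤1+n 1) 2≤N)}}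

  1≤N : 1# ≤ fromℕ N
  1≤N = ≤-respˡ-≈ (+-identityʳ 1#) (fromℕ-mono-≤ (ℕₚ.≤-trans (ℕₚ.n≤1+n 1) 2≤N))

  module _ {T : ℕ} {L : Loads} (0≤L : ∀ t → 1 ℕ.≤ t → t ℕ.≤ T → ∀ i → 0# ≤ L t i)
    {β : Vector Carrier N}
    {ε : Carrier} {0<ε : 0# < ε} (10ε≤1 : fromℕ 10 * ε ≤ 1#)
    {η : Carrier} (0<η : 0# < η) (3η≤1 : fromℕ 3 * η ≤ 1#)
    (alg : Execution T L β (ε , 0<ε) η)
    where

    open Execution alg

    E : R⁺
    E = ε , 0<ε

    λ′ : Carrier
    λ′ = λ-of E

    ℓ : Carrier
    ℓ = ln (N⁺ /⁺ E)

    0<λ′ : 0# < λ′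
    0<λ′ = proj₂ (E *⁺ E /⁺ (fromℕ⁺ 8 *⁺ N⁺))

    0≤1-ε : 0# ≤ 1# - ε
    0≤1-ε = ≤-respʳ-≈
      (solve 1 (λ e → (con (+ 1) :- con (+ 10) :* e) :+ con (+ 9) :* e := con (+ 1) :- e) refl ε)
      (0≤-+ (≤-diff 10ε≤1) (0≤-* (0≤fromℕ 9) (<⇒≤ 0<ε)))

    8λ≤ε : fromℕ 8 * λ′ ≤ ε
    8λ≤ε = ≤-by
      (0≤-+ (0≤-* (<⇒≤ 0<ε) 0≤1-ε) (0≤-* (0≤-* (0≤fromℕ 8) (<⇒≤ 0<λ′)) (≤-diff 1≤N)))
      (trans (solve 4 (λ e l n n′ → e :- con (+ 8) :* l :=
               (e :* (con (+ 1) :- e) :+ con (+ 8) :* l :* (n :- con (+ 1)))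
                 :+ con (+ 1) :* (e :* e :- l :* (con (+ 8) :* n)))
               refl ε λ′ (fromℕ N) (proj₁ N⁺))
        (≈-modulo _ 1# (trans (sym (/-cancel (ε * ε) (fromℕ⁺ 8 *⁺ N⁺))) (*-congˡ (*-congˡ N⁺≈N)))))

    -- The largest exponent in a multiplicative update, and the smallest factor
    -- by which an allocation can then shrink.
    ηmax σ κ : Carrier
    ηmax = η * (1# + λ′)
    σ = exp (- ηmax)
    κ = σ * (1# - σ)

    0≤ηmax : 0# ≤ ηmax
    0≤ηmax = 0≤-* (<⇒≤ 0<η) (0≤-+ (<⇒≤ 0<1) (<⇒≤ 0<λ′))

    -- The target is `3 σ² ≥ 1`. From `η ≤ 1/3` and `λ ≤ 1/4` follow `ηmax ≤ 5/12` and `σ ≥ 7/12`,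
    -- and `49/144` just exceeds `1/3`.
    12ηmax≤5 : fromℕ 12 * ηmax ≤ fromℕ 5
    12ηmax≤5 = ≤-by
      (0≤-+ (0≤-* (0≤-* (0≤fromℕ 4) (0≤-+ (<⇒≤ 0<1) (<⇒≤ 0<λ′))) (≤-diff 3η≤1))
        (0≤-+ (≤-diff 8λ≤ε) (0≤-+ 0≤1-ε (0≤-* (0≤fromℕ 4) (<⇒≤ 0<λ′)))))
      (solve 3 (λ η l e → con (+ 5) :- con (+ 12) :* (η :* (con (+ 1) :+ l)) :=
          con (+ 4) :* (con (+ 1) :+ l) :* (con (+ 1) :- con (+ 3) :* η)
            :+ ((e :- con (+ 8) :* l) :+ ((con (+ 1) :- e) :+ con (+ 4) :* l)))
        refl η λ′ ε)

    1-ηmax≤σ : 1# - ηmax ≤ σ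
    1-ηmax≤σ = 1+x≤exp (- ηmax)

    σ[1+ηmax]≤1 : σ * (1# + ηmax) ≤ 1#
    σ[1+ηmax]≤1 = ≤-respʳ-≈ (trans (*-comm _ _) (exp-inverse ηmax))
      (*-monoʳ-≤ (<⇒≤ (exp-pos (- ηmax))) (1+x≤exp ηmax))

    0≤12σ-7 : 0# ≤ fromℕ 12 * σ - fromℕ 7
    0≤12σ-7 = ≤-respʳ-≈
      (solve 2 (λ s c → con (+ 12) :* (s :- (con (+ 1) :- c)) :+ (con (+ 5) :- con (+ 12) :* c)
          := con (+ 12) :* s :- con (+ 7))
        refl σ ηmax)
      (0≤-+ (0≤-* (0≤fromℕ 12) (≤-diff 1-ηmax≤σ)) (≤-diff 12ηmax≤5))

    0≤3σ²-1 : 0# ≤ fromℕ 3 * (σ * σ) - 1#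
    0≤3σ²-1 = *-cancelʳ-≤ (0<1+n 143) (≤-by
      (0≤-+ (0≤-+ (0≤-* (0≤fromℕ 3) (0≤-square (fromℕ 12 * σ - fromℕ 7))) (0≤-* (0≤fromℕ 42) 0≤12σ-7))
            (0≤fromℕ 3))
      (solve 1 (λ s →
          (con (+ 3) :* (s :* s) :- con (+ 1)) :* con (+ 144) :- con (+ 0) :* con (+ 144) :=
          (con (+ 3) :* ((con (+ 12) :* s :- con (+ 7)) :* (con (+ 12) :* s :- con (+ 7)))
            :+ con (+ 42) :* (con (+ 12) :* s :- con (+ 7))) :+ con (+ 3))
        refl σ))

    -- From `σ (1 + ηmax) ≤ 1` follows `1 - σ ≥ σ ηmax`, hence `κ ≥ σ² ηmax ≥ ηmax / 3`.
    η≤3κ : η ≤ fromℕ 3 * κ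
    η≤3κ = ≤-by
      (0≤-+ (0≤-* (0≤-* (0≤fromℕ 3) (<⇒≤ (exp-pos (- ηmax)))) (≤-diff σ[1+ηmax]≤1))
        (0≤-+ (0≤-* 0≤ηmax 0≤3σ²-1) (0≤-* (<⇒≤ 0<η) (<⇒≤ 0<λ′))))
      (solve 3 (λ s η l → con (+ 3) :* (s :* (con (+ 1) :- s)) :- η :=
          con (+ 3) :* s :* (con (+ 1) :- s :* (con (+ 1) :+ η :* (con (+ 1) :+ l)))
            :+ (η :* (con (+ 1) :+ l) :* (con (+ 3) :* (s :* s) :- con (+ 1)) :+ η :* l))
        refl σ η λ′)

    0≤κ : 0# ≤ κ
    0≤κ = *-cancelʳ-≤ (0<1+n 2) (≤-trans (≤-reflexive (zeroˡ _)) (≤-respʳ-≈ (*-comm _ _) (≤-trans (<⇒≤ 0<η) η≤3κ)))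

    -- Gains and the multiplicative update

    g : ℕ → Vector Carrier N
    g t = gain E (A t) (A¹ t)

    0≤1+λ : 0# ≤ 1# + λ′
    0≤1+λ = 0≤-+ (<⇒≤ 0<1) (<⇒≤ 0<λ′)

    1≤1+λ : 1# ≤ 1# + λ′
    1≤1+λ = ≤-by (<⇒≤ 0<λ′) (solve 1 (λ l → (con (+ 1) :+ l) :- con (+ 1) := l) refl λ′)

    0≤g : ∀ t i → 0# ≤ g t i
    0≤g t i with i ∈? A¹ t | i ∈? A t
    ... | yes _ | _     = 0≤1+λ
    ... | no  _ | yes _ = <⇒≤ 0<1
    ... | no  _ | no  _ = ≤-refl

    g≤1+λ : ∀ t i → g t i ≤ 1# + λ′
    g≤1+λ t i with i ∈? A¹ t | i ∈? A t
    ... | yes _ | _     = ≤-refl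
    ... | no  _ | yes _ = 1≤1+λ
    ... | no  _ | no  _ = 0≤1+λ

    active⇒1≤g : ∀ t i → i ∈ A t → 1# ≤ g t i
    active⇒1≤g t i i∈A with i ∈? A¹ t | i ∈? A t
    ... | yes _ | _       = 1≤1+λ
    ... | no  _ | yes _   = ≤-refl
    ... | no  _ | no  i∉A = contradiction i∈A i∉A

    inactive⇒g≤0 : ∀ t → 1 ℕ.≤ t → t ℕ.≤ T → ∀ i → ¬ i ∈ A t → g t i ≤ 0#
    inactive⇒g≤0 t 1≤t t≤T i i∉A with i ∈? A¹ t | i ∈? A t
    ... | yes i∈A¹ | _       = contradiction (proj₁ (Equivalence.to (below t 1≤t t≤T i) i∈A¹)) i∉A
    ... | no  _    | yes i∈A = contradiction i∈A i∉A
    ... | no  _    | no  _   = ≤-refl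

    ln-ĥ : ∀ t i → ln (ĥ t i) ≈ lnΔ (h t) i + η * g t i
    ln-ĥ t i = trans (ln-* (coord⁺ (h t) i) (exp (η * g t i) , exp-pos (η * g t i)))
      (+-congˡ (ln-exp (exp-pos (η * g t i))))

    -- The exponentiated form of `ln-drop≤` with `c = ηmax`, as gains lie between 0 and `1 + λ`.
    shrink≤ : ∀ t → 1 ℕ.≤ t → t ℕ.≤ T → ∀ i → σ * alloc t i ≤ alloc (ℕ.suc t) i
    shrink≤ t 1≤t t≤T i = ≤-respˡ-≈
      (trans (exp-+ _ _) (trans (*-congʳ (exp-ln (coord⁺ (h t) i))) (*-comm _ _)))
      (≤-respʳ-≈ (exp-ln (coord⁺ (h (ℕ.suc t)) i))
        (exp-mono-≤ (ln-drop≤ (update t 1≤t t≤T) (h t) ηmax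
          (λ j → ≤-respʳ-≈ (sym (ln-ĥ t j))
            (≤-by (0≤-* (<⇒≤ 0<η) (0≤g t j))
              (solve 2 (λ l x → (l :+ x) :- l := x) refl (lnΔ (h t) j) (η * g t j))))
          (λ j → ≤-respˡ-≈ (sym (ln-ĥ t j))
            (+-mono-≤ ≤-refl (*-monoʳ-≤ (<⇒≤ 0<η) (g≤1+λ t j))))
          i)))

    -- The potential: its range, its growth and the work it forces

    vertex : Fin N → Δ E
    vertex i = record
      { coord = λ j → ε / N⁺ + (1# - ε) * basis i j
      ; sum≈1 = trans (∑-distrib-+ {N} (λ _ → ε / N⁺) (λ j → (1# - ε) * basis i j))
          (trans (+-cong
              (trans (sum-const N (ε / N⁺)) (trans (*-congʳ (sym N⁺≈N)) (trans (*-comm _ _) (/-cancel ε N⁺))))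
              (trans (sym (*-distribˡ-sum (1# - ε) (basis i))) (trans (*-congˡ (sum-basis i)) (*-identityʳ _))))
            (solve 1 (λ e → e :+ (con (+ 1) :- e) := con (+ 1)) refl ε))
      ; lower = λ j → ≤-by (0≤-* 0≤1-ε (0≤basis i j))
          (solve 2 (λ x y → (x :+ y) :- x := y) refl (ε / N⁺) _)
      }

    -- Up to a constant, minus the relative entropy of `vertex i` with respect to `h t`.
    Ψ : Fin N → ℕ → Carrier
    Ψ i t = sum (λ j → coord (vertex i) j * lnΔ (h t) j)

    ratio-inverse : (ε / N⁺) * proj₁ (N⁺ /⁺ E) ≈ 1#
    ratio-inverse = trans
      (solve 4 (λ e n′ n e′ → (e :* n′) :* (n :* e′) := (e :* e′) :* (n :* n′))
        refl ε (N⁺ ⁻¹) (proj₁ N⁺) (E ⁻¹))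
      (trans (*-cong (⁻¹-inverseʳ E) (⁻¹-inverseʳ N⁺)) (*-identityˡ 1#))

    exp-ℓ-inverse : exp (- ℓ) * proj₁ (N⁺ /⁺ E) ≈ 1#
    exp-ℓ-inverse = trans (*-comm _ _) (trans (*-congʳ (sym (exp-ln (N⁺ /⁺ E)))) (exp-inverse ℓ))

    -- The truncation level `ε / N` is exactly `exp (- ℓ)`.
    -ℓ≤lnΔ : ∀ (p : Δ E) j → - ℓ ≤ lnΔ p j
    -ℓ≤lnΔ p j = exp-cancel-≤ (≤-respʳ-≈ (sym (exp-ln (coord⁺ p j)))
      (≤-trans (*-cancelʳ-≤ (proj₂ (N⁺ /⁺ E)) (≤-reflexive (trans exp-ℓ-inverse (sym ratio-inverse))))
        (Δ.lower p j)))

    lnΔ≤0 : ∀ (p : Δ E) j → lnΔ p j ≤ 0#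
    lnΔ≤0 p j = exp-cancel-≤ (≤-respˡ-≈ (sym (exp-ln (coord⁺ p j)))
      (≤-respʳ-≈ (sym exp-0) (coord≤1 p j)))

    -ℓ≤Ψ : ∀ i t → - ℓ ≤ Ψ i t
    -ℓ≤Ψ i t = ≤-respˡ-≈
      (trans (sym (*-distribˡ-sum (- ℓ) (coord (vertex i))))
        (trans (*-congˡ (Δ.sum≈1 (vertex i))) (*-identityʳ _)))
      (sum-mono-≤ (λ j → ≤-respˡ-≈ (*-comm _ _)
        (*-monoʳ-≤ (<⇒≤ (Δ.coord-pos (vertex i) j)) (-ℓ≤lnΔ (h t) j))))

    Ψ≤0 : ∀ i t → Ψ i t ≤ 0#
    Ψ≤0 i t = ≤-respʳ-≈ (sum-zero {N} (λ j → zeroʳ _))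
      (sum-mono-≤ (λ j → *-monoʳ-≤ (<⇒≤ (Δ.coord-pos (vertex i) j)) (lnΔ≤0 (h t) j)))

    -- An inactive user wasted at most its allocation at time t, which is at most
    -- 1/σ times the allocation at time t + 1 that the update shrinks by σ.
    update-bound : ∀ a → ℕ.suc (ℕ.suc a) ℕ.≤ T → ∀ j → let t = ℕ.suc a in
      exp (ln (ĥ (ℕ.suc t) j) - ηmax) ≤ alloc (ℕ.suc t) j - κ * (alloc t j - w L alloc t j)
    update-bound a 2+a≤T j = ≤-respˡ-≈ (sym exp≈) (bound (j ∈? A (ℕ.suc t)))
      where
      t : ℕ
      t = ℕ.suc a

      t≤T : t ℕ.≤ T
      t≤T = ℕₚ.≤-trans (ℕₚ.n≤1+n t) 2+a≤T

      x x⁻ w⁻ : Carrier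
      x  = alloc (ℕ.suc t) j
      x⁻ = alloc t j
      w⁻ = w L alloc t j

      0≤x : 0# ≤ x
      0≤x = <⇒≤ (Δ.coord-pos (h (ℕ.suc t)) j)

      0≤w⁻ : 0# ≤ w⁻
      0≤w⁻ = 0≤w {L} {alloc} t j (0≤L t (ℕ.s≤s ℕ.z≤n) t≤T j) (<⇒≤ (Δ.coord-pos (h t) j))

      0≤1-σ : 0# ≤ 1# - σ
      0≤1-σ = ≤-diff (≤-respʳ-≈ exp-0 (exp-mono-≤ (≤-by 0≤ηmax
        (solve 1 (λ c → con (+ 0) :- (:- c) := c) refl ηmax))))

      exp≈ : exp (ln (ĥ (ℕ.suc t) j) - ηmax) ≈ x * exp (η * g (ℕ.suc t) j - ηmax)
      exp≈ = trans (exp-cong (trans (+-congʳ (ln-ĥ (ℕ.suc t) j)) (+-assoc _ _ _)))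
        (trans (exp-+ _ _) (*-congʳ (exp-ln (coord⁺ (h (ℕ.suc t)) j))))

      bound : Dec (j ∈ A (ℕ.suc t)) →
        x * exp (η * g (ℕ.suc t) j - ηmax) ≤ x - κ * (x⁻ - w⁻)
      -- Being active at time `t + 1` means that the queue left by step `t` is nonempty. The
      -- allocation at `t` was then fully used, and the subtracted term is at most 0.
      bound (yes j∈A) = ≤-trans
        (*-monoʳ-≤ 0≤x (≤-respʳ-≈ exp-0 (exp-mono-≤ (≤-by
          (0≤-* (<⇒≤ 0<η) (≤-diff (g≤1+λ (ℕ.suc t) j)))
          (solve 3 (λ η l g → con (+ 0) :- (η :* g :- η :* (con (+ 1) :+ l)) := η :* ((con (+ 1) :+ l) :- g))
            refl η λ′ (g (ℕ.suc t) j))))))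
        (≤-by (0≤-* 0≤κ (≤-diff (full-use L alloc a j (Equivalence.to (active (ℕ.suc t) (ℕ.s≤s ℕ.z≤n) 2+a≤T j) j∈A))))
          (solve 4 (λ x k y w → (x :- k :* (y :- w)) :- x :* con (+ 1) := k :* (w :- y)) refl x κ x⁻ w⁻))
      -- The factor is at most `σ`, and the freed `(1 - σ) x` pays for `κ x⁻` because `σ x⁻ ≤ x`.
      -- This dictates `κ = σ (1 - σ)`.
      bound (no j∉A) = ≤-trans
        (*-monoʳ-≤ 0≤x (exp-mono-≤ (≤-by
          (0≤-* (<⇒≤ 0<η) (≤-diff (inactive⇒g≤0 (ℕ.suc t) (ℕ.s≤s ℕ.z≤n) 2+a≤T j j∉A)))
          (solve 3 (λ η g c → (:- c) :- (η :* g :- c) := η :* (con (+ 0) :- g))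
            refl η (g (ℕ.suc t) j) ηmax))))
        (≤-by (0≤-+ (0≤-* 0≤1-σ (≤-diff (shrink≤ t (ℕ.s≤s ℕ.z≤n) t≤T j))) (0≤-* 0≤κ 0≤w⁻))
          (solve 4 (λ x s y w → (x :- s :* (con (+ 1) :- s) :* (y :- w)) :- x :* s :=
              (con (+ 1) :- s) :* (x :- s :* y) :+ s :* (con (+ 1) :- s) :* w)
            refl x σ x⁻ w⁻))

    -- In `progress`, `c = ηmax` costs `η (1 + λ)`, while the gain of the active user `i` gives back
    -- at least `η (1 - ε)` through its weight in `vertex i`. The net loss is `η (λ + ε)`.
    Ψ-step : ∀ a i → ℕ.suc (ℕ.suc a) ℕ.≤ T → let t = ℕ.suc a in
      0# < Q L alloc (ℕ.suc t) i →
      Ψ i (ℕ.suc t) + κ * (1# - sum (w L alloc t)) ≤ Ψ i (ℕ.suc (ℕ.suc t)) + η * (λ′ + ε)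
    Ψ-step a i 2+a≤T 0<Q = ≤-by
      (≤-diff (≤-trans
        (progress (update (ℕ.suc t) (ℕ.s≤s ℕ.z≤n) 2+a≤T) (h (ℕ.suc t)) ηmax r (update-bound a 2+a≤T) (vertex i))
        (≤-respʳ-≈ sum≈ (sum-mono-≤ pointwise))))
      (trans (solve 8 (λ p p′ k W η l e r →
            (p′ :+ η :* (l :+ e)) :- (p :+ k :* (con (+ 1) :- W)) :=
            (((p′ :- p) :- η :* (con (+ 1) :- e)) :- (r :- η :* (con (+ 1) :+ l)))
              :+ con (+ 1) :* (r :- k :* (con (+ 1) :- W)))
          refl (Ψ i (ℕ.suc t)) (Ψ i (ℕ.suc (ℕ.suc t))) κ (sum (w L alloc t)) η λ′ ε (sum r))
        (≈-modulo _ _ sum-r))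
      where
      t : ℕ
      t = ℕ.suc a

      u γ : Vector Carrier N
      u = coord (vertex i)
      γ = g (ℕ.suc t)

      r : Vector Carrier N
      r j = κ * (alloc t j - w L alloc t j)

      sum-r : sum r ≈ κ * (1# - sum (w L alloc t))
      sum-r = trans (sym (*-distribˡ-sum κ (λ j → alloc t j - w L alloc t j)))
        (*-congˡ (trans (∑-distrib-minus (alloc t) (w L alloc t)) (+-congʳ (Δ.sum≈1 (h t)))))

      0≤basis-gain : ∀ j → 0# ≤ basis i j * (γ j - 1#)
      0≤basis-gain j with i Fin.≟ j
      ... | yes ≡.refl = 0≤-* (0≤basis i i) (≤-diff (active⇒1≤g (ℕ.suc t) i
              (Equivalence.from (active (ℕ.suc t) (ℕ.s≤s ℕ.z≤n) 2+a≤T i) 0<Q)))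
      ... | no i≢j = ≤-reflexive (sym (trans (*-congʳ (basis-≢ i≢j)) (zeroˡ _)))

      pointwise : ∀ j → u j * (lnΔ (h (ℕ.suc (ℕ.suc t))) j - ln (ĥ (ℕ.suc t) j)) ≤
        (u j * lnΔ (h (ℕ.suc (ℕ.suc t))) j - u j * lnΔ (h (ℕ.suc t)) j) - η * (1# - ε) * basis i j
      pointwise j = ≤-by
        (0≤-* (<⇒≤ 0<η) (0≤-+ (0≤-* (<⇒≤ (proj₂ (E /⁺ N⁺))) (0≤g (ℕ.suc t) j)) (0≤-* 0≤1-ε (0≤basis-gain j))))
        (trans (+-congˡ (-‿cong (*-congˡ (+-congˡ (-‿cong (ln-ĥ (ℕ.suc t) j))))))
          (solve 7 (λ m e b lp lh η g →
              (((m :+ (con (+ 1) :- e) :* b) :* lp :- (m :+ (con (+ 1) :- e) :* b) :* lh) :- η :* (con (+ 1) :- e) :* b)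
                :- (m :+ (con (+ 1) :- e) :* b) :* (lp :- (lh :+ η :* g)) :=
              η :* (m :* g :+ (con (+ 1) :- e) :* (b :* (g :- con (+ 1)))))
            refl (ε / N⁺) ε (basis i j) (lnΔ (h (ℕ.suc (ℕ.suc t))) j) (lnΔ (h (ℕ.suc t)) j) η (γ j)))

      sum≈ : sum (λ j → (u j * lnΔ (h (ℕ.suc (ℕ.suc t))) j - u j * lnΔ (h (ℕ.suc t)) j) - η * (1# - ε) * basis i j)
        ≈ (Ψ i (ℕ.suc (ℕ.suc t)) - Ψ i (ℕ.suc t)) - η * (1# - ε)
      sum≈ = trans
        (∑-distrib-minus (λ j → u j * lnΔ (h (ℕ.suc (ℕ.suc t))) j - u j * lnΔ (h (ℕ.suc t)) j) (λ j → η * (1# - ε) * basis i j))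
        (+-cong (∑-distrib-minus (λ j → u j * lnΔ (h (ℕ.suc (ℕ.suc t))) j) (λ j → u j * lnΔ (h (ℕ.suc t)) j))
          (-‿cong (trans (sym (*-distribˡ-sum (η * (1# - ε)) (basis i)))
            (trans (*-congˡ (sum-basis i)) (*-identityʳ _)))))

    -- `Ψ-step` telescoped. The waste of steps `a + 1` to `a + k` is seen by the updates one step
    -- later, which shifts the times of activity and of the potential by one.
    Ψ-window : ∀ k a i → ℕ.suc (k ℕ.+ a) ℕ.≤ T →
      (∀ j → j ℕ.< k → 0# < Q L alloc (ℕ.suc (ℕ.suc (j ℕ.+ a))) i) →
      Ψ i (ℕ.suc (ℕ.suc a)) + κ * (fromℕ k - (work L alloc (k ℕ.+ a) - work L alloc a)) ≤
      Ψ i (ℕ.suc (ℕ.suc (k ℕ.+ a))) + fromℕ k * (η * (λ′ + ε))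
    Ψ-window ℕ.zero a i _ _ = ≤-reflexive
      (solve 4 (λ p k W z → p :+ k :* (con (+ 0) :- (W :- W)) := p :+ con (+ 0) :* z) refl _ κ (work L alloc a) _)
    Ψ-window (ℕ.suc k) a i 2+k+a≤T act = ≤-by
      (0≤-+ (≤-diff (Ψ-window k a i (ℕₚ.≤-trans (ℕₚ.n≤1+n _) 2+k+a≤T) (λ j j<k → act j (m≤n⇒m≤1+n j<k))))
            (≤-diff (Ψ-step (k ℕ.+ a) i 2+k+a≤T (act k ℕₚ.≤-refl))))
      (solve 9 (λ p₀ p₁ p₂ κ k W W₀ s z →
          (p₂ :+ (con (+ 1) :+ k) :* z) :- (p₀ :+ κ :* ((con (+ 1) :+ k) :- ((W :+ s) :- W₀))) :=
          ((p₁ :+ k :* z) :- (p₀ :+ κ :* (k :- (W :- W₀))))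
            :+ ((p₂ :+ z) :- (p₁ :+ κ :* (con (+ 1) :- s))))
        refl (Ψ i (ℕ.suc (ℕ.suc a))) (Ψ i (ℕ.suc (ℕ.suc (k ℕ.+ a)))) (Ψ i (ℕ.suc (ℕ.suc (ℕ.suc k ℕ.+ a))))
          κ (fromℕ k) (work L alloc (k ℕ.+ a)) (work L alloc a) (sum (w L alloc (ℕ.suc (k ℕ.+ a)))) (η * (λ′ + ε)))

    -- The potential rises by at most `ℓ` overall, so over a long window of activity the average
    -- waste per step stays below `4 ε`.
    near-full-work : ∀ k a i → ℕ.suc (k ℕ.+ a) ℕ.≤ T →
      (∀ j → j ℕ.< k → 0# < Q L alloc (ℕ.suc (ℕ.suc (j ℕ.+ a))) i) →
      fromℕ 6 * ℓ ≤ fromℕ k * (ε * η) →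
      fromℕ k * (1# - fromℕ 4 * ε) ≤ work L alloc (k ℕ.+ a) - work L alloc a
    near-full-work k a i k+a<T act 6ℓ≤kεη W<k[1-4ε] = (≤-by {fromℕ 8 * (η * D)} {0#}
        -- Budget in units of `k ε η`, with `Ψ-window` scaled by 24: a waste above `4 ε k`
        -- contributes more than 32 by `η ≤ 3 κ`. The costs are at most 4 for `ℓ`, 3 for `λ` and 24
        -- for `ε`, 31 in total.
        (0≤-+ (0≤-* (0≤fromℕ 24) (≤-diff (Ψ-window k a i k+a<T act)))
        (0≤-+ (0≤-* (0≤fromℕ 24) (≤-diff (Ψ≤0 i (ℕ.suc (ℕ.suc (k ℕ.+ a))))))
        (0≤-+ (0≤-* (0≤fromℕ 24) (≤-diff (-ℓ≤Ψ i (ℕ.suc (ℕ.suc a)))))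
        (0≤-+ (0≤-* (0≤fromℕ 4) (≤-diff 6ℓ≤kεη))
        (0≤-+ (0≤-* (0≤-* (0≤-* (0≤fromℕ 3) (0≤fromℕ k)) (<⇒≤ 0<η)) (≤-diff 8λ≤ε))
        (0≤-+ (0≤-* (0≤-* (0≤fromℕ k) (<⇒≤ 0<η)) (<⇒≤ 0<ε))
        (0≤-+ (0≤-* (0≤-* (0≤fromℕ 8) (<⇒≤ (<-diff W<k[1-4ε]))) (≤-diff η≤3κ))
              (0≤-* (0≤-* (0≤-* (0≤fromℕ 32) (0≤fromℕ k)) (<⇒≤ 0<ε)) (≤-diff η≤3κ)))))))))
        (solve 9 (λ p p′ κ k ΔW η l e ℓ →
            con (+ 0) :- con (+ 8) :* (η :* (k :* (con (+ 1) :- con (+ 4) :* e) :- ΔW)) :=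
            con (+ 24) :* ((p′ :+ k :* (η :* (l :+ e))) :- (p :+ κ :* (k :- ΔW)))
            :+ (con (+ 24) :* (con (+ 0) :- p′)
            :+ (con (+ 24) :* (p :- (:- ℓ))
            :+ (con (+ 4) :* (k :* (e :* η) :- con (+ 6) :* ℓ)
            :+ (con (+ 3) :* k :* η :* (e :- con (+ 8) :* l)
            :+ (k :* η :* e
            :+ (con (+ 8) :* (k :* (con (+ 1) :- con (+ 4) :* e) :- ΔW) :* (con (+ 3) :* κ :- η)
            :+ con (+ 32) :* k :* e :* (con (+ 3) :* κ :- η))))))))
          refl (Ψ i (ℕ.suc (ℕ.suc a))) (Ψ i (ℕ.suc (ℕ.suc (k ℕ.+ a)))) κ (fromℕ k) (work L alloc (k ℕ.+ a) - work L alloc a) η λ′ ε ℓ))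
      (*-pos (0<1+n 7) (*-pos 0<η (<-diff W<k[1-4ε])))
      where
      D : Carrier
      D = fromℕ k * (1# - fromℕ 4 * ε) - (work L alloc (k ℕ.+ a) - work L alloc a)

    work-mono-≤ : ∀ k a → k ℕ.+ a ℕ.≤ T → work L alloc a ≤ work L alloc (k ℕ.+ a)
    work-mono-≤ ℕ.zero    a _       = ≤-refl
    work-mono-≤ (ℕ.suc k) a 1+k+a≤T = ≤-trans (work-mono-≤ k a (ℕₚ.≤-trans (ℕₚ.n≤1+n _) 1+k+a≤T))
      (≤-respˡ-≈ (+-identityʳ _) (+-mono-≤ ≤-refl (0≤-sum (λ i →
        0≤w {L} {alloc} t i (0≤L t (ℕ.s≤s ℕ.z≤n) 1+k+a≤T i) (<⇒≤ (Δ.coord-pos (h t) i))))))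
      where
      t : ℕ
      t = ℕ.suc (k ℕ.+ a)

    -- The gap to the offline allocations

    module _ {h* : Allocations} (feasible : AreAllocations T (fromℕ 4 * ε) h*) where

      gap : ℕ → Carrier
      gap t = work L h* t - work L alloc t

      offline-work≤ : ∀ k a → k ℕ.+ a ℕ.≤ T →
        work L h* (k ℕ.+ a) ≤ work L h* a + fromℕ k * (1# - fromℕ 4 * ε)
      offline-work≤ ℕ.zero    a _       = ≤-reflexive
        (solve 2 (λ W x → W := W :+ con (+ 0) :* x) refl (work L h* a) _)
      offline-work≤ (ℕ.suc k) a 1+k+a≤T = ≤-trans
        (+-mono-≤ (offline-work≤ k a (ℕₚ.≤-trans (ℕₚ.n≤1+n _) 1+k+a≤T))
          (≤-trans (sum-mono-≤ (λ i → x∧y≤x (h* t i) _))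
            (IsAllocation.capacity (feasible t (ℕ.s≤s ℕ.z≤n) 1+k+a≤T))))
        (≤-reflexive (solve 3 (λ W k x → (W :+ k :* x) :+ x := W :+ (con (+ 1) :+ k) :* x)
          refl (work L h* a) (fromℕ k) _))
        where
        t : ℕ
        t = ℕ.suc (k ℕ.+ a)

      gap-growth : ∀ k a → k ℕ.+ a ℕ.≤ T → gap (k ℕ.+ a) ≤ gap a + fromℕ k
      gap-growth k a k+a≤T = ≤-by
        (0≤-+ (≤-diff (offline-work≤ k a k+a≤T))
          (0≤-+ (≤-diff (work-mono-≤ k a k+a≤T)) (0≤-* (0≤fromℕ k) (0≤-* (0≤fromℕ 4) (<⇒≤ 0<ε)))))
        (solve 6 (λ W*′ W* W′ W k e → ((W* :- W) :+ k) :- (W*′ :- W′) :=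
            ((W* :+ k :* (con (+ 1) :- con (+ 4) :* e)) :- W*′) :+ ((W′ :- W) :+ k :* (con (+ 4) :* e)))
          refl (work L h* (k ℕ.+ a)) (work L h* a) (work L alloc (k ℕ.+ a)) (work L alloc a) (fromℕ k) ε)

      module _ {M : ℕ} (1≤M : 1 ℕ.≤ M) (6ℓ≤Mεη : fromℕ 6 * ℓ ≤ fromℕ M * (ε * η)) where

        X : Carrier
        X = fromℕ N * fromℕ M

        -- A queue above `M` loses at most 1 per step, so user `i` stays active throughout the
        -- window and `near-full-work` matches the offline capacity.
        gap-window : ∀ a i → ℕ.suc (M ℕ.+ a) ℕ.≤ T →
          fromℕ M < Q L alloc (ℕ.suc a) i → gap (M ℕ.+ a) ≤ gap a
        gap-window a i M+a<T M<Q = ≤-by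
          (0≤-+ (≤-diff (offline-work≤ M a (ℕₚ.≤-trans (ℕₚ.n≤1+n _) M+a<T)))
                (≤-diff (near-full-work M a i M+a<T stays-active 6ℓ≤Mεη)))
          (solve 5 (λ W*′ W* W′ W x → (W* :- W) :- (W*′ :- W′) :=
              ((W* :+ x) :- W*′) :+ ((W′ :- W) :- x))
            refl (work L h* (M ℕ.+ a)) (work L h* a) (work L alloc (M ℕ.+ a)) (work L alloc a) _)
          where
          stays-active : ∀ j → j ℕ.< M → 0# < Q L alloc (ℕ.suc (ℕ.suc (j ℕ.+ a))) i
          stays-active j j<M = <-by
            (0<-+ (<-diff M<Q) (0≤-+ (≤-diff (fromℕ-mono-≤ j<M))
              (≤-diff (Q-decay {L} {alloc} (ℕ.suc j) a i
                (λ t 1≤t t≤ → 0≤L t 1≤t (ℕₚ.≤-trans t≤ 1+j+a≤T) i)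
                (λ t _ _ → coord≤1 (h t) i)))))
            (solve 4 (λ q q′ M j → q′ :- con (+ 0) := (q :- M) :+ ((M :- j) :+ ((j :+ q′) :- q)))
              refl (Q L alloc (ℕ.suc a) i) (Q L alloc (ℕ.suc (ℕ.suc (j ℕ.+ a))) i) (fromℕ M) (fromℕ (ℕ.suc j)))
            where
            1+j+a≤T : ℕ.suc j ℕ.+ a ℕ.≤ T
            1+j+a≤T = ℕₚ.≤-trans (ℕₚ.+-monoˡ-≤ a j<M) (ℕₚ.≤-trans (ℕₚ.n≤1+n _) M+a<T)

        -- The invariant `gap a ≤ X + 1` is carried along checkpoints `a` that advance by 1 or by
        -- `M`, with `k` steps remaining; the last `M` steps add at most `M`. Jumps by `M` are not
        -- structural, hence `fuel`.
        gap-bound : ∀ fuel k a → k ℕ.≤ fuel → k ℕ.+ a ℕ.≤ T →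
          gap a ≤ X + 1# → gap (k ℕ.+ a) ≤ X + 1# + fromℕ M
        gap-bound fuel k a k≤fuel k+a≤T gap≤ with k ℕₚ.≤? M
        ... | yes k≤M = ≤-trans (gap-growth k a k+a≤T) (+-mono-≤ gap≤ (fromℕ-mono-≤ k≤M))
        gap-bound ℕ.zero       ℕ.zero    a k≤fuel k+a≤T gap≤ | no k≰M = contradiction ℕ.z≤n k≰M
        gap-bound (ℕ.suc fuel) ℕ.zero    a k≤fuel k+a≤T gap≤ | no k≰M = contradiction ℕ.z≤n k≰M
        gap-bound (ℕ.suc fuel) k@(ℕ.suc k′) a (ℕ.s≤s k′≤fuel) k+a≤T gap≤ | no k≰M =
          by-cases X (sum (Q L alloc (ℕ.suc a))) backlogged light
          where
          M<k : M ℕ.< k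
          M<k = ℕₚ.≰⇒> k≰M

          M+a<T : ℕ.suc (M ℕ.+ a) ℕ.≤ T
          M+a<T = ℕₚ.≤-trans (ℕₚ.+-monoˡ-≤ a M<k) k+a≤T

          shift : k ℕ.∸ M ℕ.+ (M ℕ.+ a) ≡ k ℕ.+ a
          shift = ≡.trans (≡.sym (ℕₚ.+-assoc (k ℕ.∸ M) M a))
            (≡.cong (ℕ._+ a) (ℕₚ.m∸n+n≡m (ℕₚ.<⇒≤ M<k)))

          skip : ∀ i → fromℕ M < Q L alloc (ℕ.suc a) i → gap (k ℕ.+ a) ≤ X + 1# + fromℕ M
          skip i M<Q = ≡.subst (λ t → gap t ≤ X + 1# + fromℕ M) shift
            (gap-bound fuel (k ℕ.∸ M) (M ℕ.+ a)
              (ℕₚ.≤-trans (ℕₚ.∸-monoʳ-≤ k 1≤M) k′≤fuel)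
              (≡.subst (ℕ._≤ T) (≡.sym shift) k+a≤T)
              (≤-trans (gap-window a i M+a<T M<Q) gap≤))

          -- Pigeonhole by contradiction: if the bound failed, `skip` would exclude every queue
          -- above `M`, and the total would be at most `N M = X`.
          backlogged : X < sum (Q L alloc (ℕ.suc a)) → gap (k ℕ.+ a) ≤ X + 1# + fromℕ M
          backlogged X<ΣQ violated = ≤-respʳ-≈ (sum-const N (fromℕ M))
            (sum-mono-≤ (λ i M<Q → skip i M<Q violated)) X<ΣQ

          -- The total queue resets the gap to at most `X`, and a single step restores the invariant
          -- `X + 1`.
          light : sum (Q L alloc (ℕ.suc a)) ≤ X → gap (k ℕ.+ a) ≤ X + 1# + fromℕ M
          light ΣQ≤X = ≡.subst (λ t → gap t ≤ X + 1# + fromℕ M) (+-suc k′ a)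
            (gap-bound fuel k′ (ℕ.suc a) k′≤fuel (≡.subst (ℕ._≤ T) (≡.sym (+-suc k′ a)) k+a≤T)
              (≤-trans (gap-growth 1 a (ℕₚ.≤-trans (ℕ.s≤s (ℕₚ.m≤n+m a k′)) k+a≤T))
                (+-mono-≤ (≤-trans (work-diff≤ΣQ L alloc h* a) ΣQ≤X) (≤-reflexive (+-identityʳ 1#)))))

      -- Choice of the window length

      εη≤ℓ : ε * η ≤ ℓ
      -- From `1 - ℓ ≤ exp (- ℓ) ≤ ε` follows `ℓ ≥ 1 - ε`, which exceeds `ε η` for the small
      -- parameters at hand.
      εη≤ℓ = ≤-by
        (0≤-+ (≤-diff exp-ℓ≤ε) (0≤-+ (≤-diff (1+x≤exp (- ℓ)))
          (0≤-+ (≤-diff 10ε≤1) (0≤-+ (0≤-* (0≤fromℕ 8) (<⇒≤ 0<ε))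
            (0≤-* (<⇒≤ 0<ε) (0≤-+ (≤-diff 3η≤1) (0≤-* (0≤fromℕ 2) (<⇒≤ 0<η))))))))
        (solve 4 (λ e η ℓ x → ℓ :- e :* η :=
            (e :- x) :+ ((x :- (con (+ 1) :- ℓ)) :+ ((con (+ 1) :- con (+ 10) :* e)
              :+ (con (+ 8) :* e :+ e :* ((con (+ 1) :- con (+ 3) :* η) :+ con (+ 2) :* η)))))
          refl ε η ℓ (exp (- ℓ)))
        where
        exp-ℓ≤ε : exp (- ℓ) ≤ ε
        exp-ℓ≤ε = *-cancelʳ-≤ (proj₂ (N⁺ /⁺ E))
          (≤-respˡ-≈ (sym exp-ℓ-inverse)
            (≤-respʳ-≈ (sym (trans (*-comm _ _) (trans (/-cancel (proj₁ N⁺) E) N⁺≈N))) 1≤N))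

      -- The window length is `M = m + 1` with `m` the floor of `6 ℓ / (ε η)`. The floor is
      -- available because the goal is a negation.
      gap≤ : ∀ t → t ℕ.≤ T → gap t ≤ fromℕ 8 * (fromℕ N / (E *⁺ E *⁺ (η , 0<η))) * ℓ
      gap≤ t t≤T violated = floor-exists 0≤x λ (m , m≤x , x<1+m) →
        ≤-trans
          (≡.subst (λ s → gap s ≤ fromℕ N * fromℕ (ℕ.suc m) + 1# + fromℕ (ℕ.suc m)) (ℕₚ.+-identityʳ t)
            (gap-bound {ℕ.suc m} (ℕ.s≤s ℕ.z≤n) (scale≤ (<⇒≤ x<1+m)) t t 0 ℕₚ.≤-refl
              (≡.subst (ℕ._≤ T) (≡.sym (ℕₚ.+-identityʳ t)) t≤T) (gap₀≤ {ℕ.suc m})))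
          (total≤ m (≤-respʳ-≈ (/-cancel _ ε⁺η) (*-monoˡ-≤ (<⇒≤ (proj₂ ε⁺η)) m≤x)))
          violated
        where
        ε⁺η Z : R⁺
        ε⁺η = E *⁺ (η , 0<η)
        Z   = E *⁺ E *⁺ (η , 0<η)

        x : Carrier
        x = fromℕ 6 * ℓ / ε⁺η

        0≤ℓ : 0# ≤ ℓ
        0≤ℓ = ≤-trans (<⇒≤ (proj₂ ε⁺η)) εη≤ℓ

        0≤x : 0# ≤ x
        0≤x = 0≤-* (0≤-* (0≤fromℕ 6) 0≤ℓ) (<⇒≤ (⁻¹-pos ε⁺η))

        scale≤ : ∀ {y} → x ≤ y → fromℕ 6 * ℓ ≤ y * (ε * η)
        scale≤ x≤y = ≤-respˡ-≈ (/-cancel _ ε⁺η) (*-monoˡ-≤ (<⇒≤ (proj₂ ε⁺η)) x≤y)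

        gap₀≤ : ∀ {m} → gap 0 ≤ fromℕ N * fromℕ m + 1#
        gap₀≤ {m} = ≤-respˡ-≈ (sym (-‿inverseʳ 0#)) (0≤-+ (0≤-* (0≤fromℕ N) (0≤fromℕ m)) (<⇒≤ 0<1))

        -- Times `ε² η`, the left side is at most `ε (7 (N + 1) + 1) ℓ`, using `ε η ≤ ℓ` for the
        -- rounding and the additive 1. This is at most `15 ε N ℓ`, and `15 ε ≤ 8`.
        total≤ : ∀ m → fromℕ m * (ε * η) ≤ fromℕ 6 * ℓ →
          fromℕ N * fromℕ (ℕ.suc m) + 1# + fromℕ (ℕ.suc m) ≤ fromℕ 8 * (fromℕ N / Z) * ℓ
        total≤ m mεη≤6ℓ = *-cancelʳ-≤ (proj₂ Z) (≤-respʳ-≈ (sym clear) (≤-by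
          (0≤-+ (0≤-* (<⇒≤ 0<ε) (0≤-+ (0≤-* (0≤-* (0≤fromℕ 8) 0≤ℓ) (≤-diff 1≤N))
                  (0≤-+ (0≤-* (0≤-+ (0≤fromℕ N) (<⇒≤ 0<1)) (0≤-+ (≤-diff εη≤ℓ) (≤-diff mεη≤6ℓ))) (≤-diff εη≤ℓ))))
                (0≤-* (0≤-* (0≤fromℕ N) 0≤ℓ) (0≤-+ (≤-diff 10ε≤1) (0≤-+ (0≤-* (0≤fromℕ 5) 0≤1-ε) (0≤fromℕ 2)))))
          (solve 5 (λ n ℓ e η m →
              con (+ 8) :* n :* ℓ :- (n :* (con (+ 1) :+ m) :+ con (+ 1) :+ (con (+ 1) :+ m)) :* (e :* e :* η) :=
              e :* (con (+ 8) :* ℓ :* (n :- con (+ 1))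
                :+ ((n :+ con (+ 1)) :* ((ℓ :- e :* η) :+ (con (+ 6) :* ℓ :- m :* (e :* η))) :+ (ℓ :- e :* η)))
              :+ n :* ℓ :* ((con (+ 1) :- con (+ 10) :* e) :+ (con (+ 5) :* (con (+ 1) :- e) :+ con (+ 2))))
            refl (fromℕ N) ℓ ε η (fromℕ m))))
          where
          clear : fromℕ 8 * (fromℕ N / Z) * ℓ * proj₁ Z ≈ fromℕ 8 * fromℕ N * ℓ
          clear = trans
            (solve 4 (λ c y ℓ z → c :* y :* ℓ :* z := c :* (y :* z) :* ℓ)
              refl (fromℕ 8) (fromℕ N / Z) ℓ (proj₁ Z))
            (*-congʳ (*-congˡ (/-cancel (fromℕ N) Z)))

-- The bound for the given parameters, with their denominators cleared

theorem3 :
    ∀ {c ℓ₁ ℓ₂} (R : Reals c ℓ₁ ℓ₂) (N : ℕ) (2≤N : 2 ℕ.≤ N) →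
    let open Reals R
        open SharedResource R N 2≤N
    in
    (T : ℕ) → 1 ℕ.≤ T →
    (L : Loads) → (∀ t → 1 ℕ.≤ t → t ℕ.≤ T → ∀ i → 0# ≤ L t i) →
    (β : Vector Carrier N) → (∀ i → 0# ≤ β i) → sum β ≤ 1# →
    (ε : Carrier) (0<ε : 0# < ε) → ε ≤ 1# / fromℕ⁺ 10 →
    (η : Carrier) (0<η : 0# < η) → η < 1# / fromℕ⁺ 3 →
    (alg : Execution T L β (ε , 0<ε) η) →
    (h* : Allocations) → IsOptimalOffline T L (fromℕ 4 * ε) h* →
    (t : ℕ) → 1 ℕ.≤ t → t ℕ.≤ T →
    work L h* t - work L (Execution.alloc alg) t
      ≤ fromℕ 8 * (fromℕ N / ((ε , 0<ε) *⁺ (ε , 0<ε) *⁺ (η , 0<η))) * ln (N⁺ /⁺ (ε , 0<ε))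
theorem3 R N 2≤N T _ L 0≤L β _ _ ε 0<ε ε≤1/10 η 0<η η<1/3 alg h* optimal t _ t≤T =
  Analysis.gap≤ R N 2≤N 0≤L {0<ε = 0<ε} (≤-/⇒*-≤ {z = fromℕ⁺ 10} ε≤1/10)
    0<η (≤-/⇒*-≤ {z = fromℕ⁺ 3} (<⇒≤ η<1/3))
    alg (IsOptimalOffline.feasible optimal) t t≤T
  where
  open Reals R using (fromℕ⁺)
  open RealProperties R using (<⇒≤; ≤-/⇒*-≤)
  open SharedResource R N 2≤N using (module IsOptimalOffline)
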